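{- Every tournament $H$ on six vertices that is not isomorphic to $H_D$ satisfies the Erdős–Hajnal Conjecture: there exists $\epsilon(H)>0$ such that every tournament $T$ not containing $H$ as a subtournament contains a transitive subtournament on at least $|T|^{\epsilon(H)}$ vertices.
   Context: Tournaments are finite; subtournament = induced subtournament; transitive = no directed cycle. Given an ordering of the vertices, an edge $(x,y)$ is backward if $y$ precedes $x$; a tournament on an ordered vertex set is determined by its backward edges. $H_D$ is the tournament with vertex set $\{1,\dots,6\}$ whose backward edges under the ordering $(1,2,3,4,5,6)$ are exactly $(4,1),(6,3),(5,2),(6,1)$. -}

module Defs where

open import Data.Nat using (ℕ; zero; suc; _≤_; _^_)
open import Data.Fin using (Fin; zero; suc; toℕ; inject₁; fromℕ)
open import Data.Bool using (Bool; true; false; not; _∧_; _∨_)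
open import Data.Nat using (_<ᵇ_; _≡ᵇ_)
open import Data.Product using (Σ; ∃; _×_; _,_)
open import Relation.Binary.PropositionalEquality using (_≡_; _≢_)
open import Relation.Nullary using (¬_)
open import Function.Definitions using (Injective)
open import Function.Bundles using (_⤖_; module Bijection)

Digraph : ℕ → Set
Digraph n = Fin n → Fin n → Bool

record IsTournament {n : ℕ} (T : Digraph n) : Set where
  field
    irrefl : ∀ x → T x x ≡ false
    total  : ∀ x y → x ≢ y → T x y ≡ not (T y x)

record DirectedCycle {n : ℕ} (T : Digraph n) : Set where
  field
    len   : ℕ
    cyc   : Fin (suc len) → Fin n
    inj   : Injective _≡_ _≡_ cyc
    step  : ∀ (i : Fin len) → T (cyc (inject₁ i)) (cyc (suc i)) ≡ true
    close : T (cyc (fromℕ len)) (cyc zero) ≡ true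

IsTransitive : ∀ {n} → Digraph n → Set
IsTransitive T = ¬ DirectedCycle T

induced : ∀ {m n} → Digraph n → (Fin m → Fin n) → Digraph m
induced T f x y = T (f x) (f y)

Contains : ∀ {n m} → Digraph n → Digraph m → Set
Contains {n} {m} T H =
  Σ (Fin m → Fin n) λ f → Injective _≡_ _≡_ f × (∀ x y → H x y ≡ induced T f x y)

Isomorphic : ∀ {m} → Digraph m → Digraph m → Set
Isomorphic {m} H H' =
  Σ (Fin m ⤖ Fin m) λ b →
    ∀ x y → H x y ≡ H' (Bijection.to b x) (Bijection.to b y)

HasTransitiveSub : ∀ {n} → Digraph n → ℕ → Set
HasTransitiveSub {n} T k =
  Σ (Fin k → Fin n) λ f → Injective _≡_ _≡_ f × IsTransitive (induced T f)

-- H_D on vertices {1,…,6} (represented by Fin 6 as 0,…,5).  Under the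
-- ordering (1,…,6) the backward edges are exactly (4,1),(6,3),(5,2),(6,1),
-- i.e. (3,0),(5,2),(4,1),(5,0) zero-indexed; all other edges go forward.
backD : ℕ → ℕ → Bool
backD 3 0 = true
backD 5 2 = true
backD 4 1 = true
backD 5 0 = true
backD _ _ = false

H-D : Digraph 6
H-D x y = ((toℕ x <ᵇ toℕ y) ∧ not (backD (toℕ y) (toℕ x))) ∨ backD (toℕ x) (toℕ y)

{-# OPTIONS --safe #-}
module Submission where

-- A minimal counterexample T has no long transitive subtournament, while every linear-sized vertex set A
-- contains a transitive set almost as large as the largest one of T; so such an A is never complete to or from
-- a transitive set Y of comparable size. As T avoids H, it contains linear-sized sets P₀ , … , P₆ with almost all
-- arcs between them directed forwards; replacing P₃ by a long transitive subset and cutting it into intervals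
-- gives slots for the vertices of H. A typical vertex of a linear slot has arcs in both directions to every
-- interval, so stars with centres in linear slots and leaves in intervals can be embedded one after the other.
-- Moreover there are a left slot and a right slot joined by a backward arc (y , x) of typical vertices: either
-- some central interval contains s with y → s → x, or x and y have leaves there that are leaves of only one of them.
-- Every tournament on six vertices except H-D has an ordering whose backward arcs are stars of this kind, or
-- has two orderings, one for each of the two outcomes for the pair x , y.

open import Defs
open import Data.Bool using (Bool; true; false; not; _∧_; _∨_; if_then_else_; T?) renaming (T to T′; _≟_ to _≟ᵇ_)
open import Data.Bool.Properties using (not-involutive; T-≡)
open import Data.Empty using (⊥-elim)
open import Data.Fin as Fin using (Fin; zero; suc; toℕ; #_; punchIn; fromℕ; inject₁; punchOut)
open import Data.Fin.Properties as Finₚ using (any?; punchIn-injective; punchInᵢ≢i; punchOut-injective; injective⇒≤)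
open import Data.List using (List; []; _∷_; _++_; length; take; drop; filterᵇ; allFin; map; lookup)
open import Data.List.Membership.Propositional using (_∈_; find; lose)
open import Data.List.Membership.Propositional.Properties using (∈-filter⁺; ∈-filter⁻; ∈-allFin; ∈-map⁻; ∈-lookup; ∈-++⁻)
open import Data.List.Properties using (length-take; length-drop; length-tabulate; length-++; length-map)
open import Data.List.Relation.Binary.Sublist.Propositional using (_⊆_; []; _∷_; _∷ʳ_; ⊆-refl; ⊆-trans) renaming (lookup to ⊆-lookup)
open import Data.List.Relation.Binary.Sublist.Propositional.Properties using (filter-⊆; take-⊆; drop-⊆)
open import Data.List.Relation.Unary.All as All using (All; []; _∷_; all?)
open import Data.List.Relation.Unary.AllPairs using (AllPairs; []; _∷_)
open import Data.List.Relation.Unary.AllPairs.Properties as AllPairs using (++⁺)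
open import Data.List.Relation.Unary.Any as Any using (here; there)
open import Data.List.Relation.Unary.Unique.Propositional using (Unique)
open import Data.List.Relation.Unary.Unique.Propositional.Properties using (allFin⁺)
open import Data.Maybe using (Maybe; just; nothing)
open import Data.Maybe.Properties as Maybe using (≡-dec)
open import Data.Nat using (ℕ; zero; suc; _+_; _*_; _∸_; _^_; _≤_; _<_; z≤n; s≤s; s≤s⁻¹; z<s; _≤?_; _<?_; _≤ᵇ_; _<ᵇ_; NonZero; >-nonZero; _≡ᵇ_; _>_)
open import Data.Nat.DivMod using (_/_; _%_; m≡m%n+[m/n]*n; m%n<n; _mod_)
open import Data.Nat.Induction using (<-rec)
open import Data.Nat.Properties
open import Data.Nat.Tactic.RingSolver using (solve-∀)
open import Data.Product using (Σ; ∃; ∃₂; _×_; _,_; proj₁; proj₂)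
open import Data.Sum using (_⊎_; inj₁; inj₂)
open import Data.Vec as Vec using (Vec; []; _∷_; tabulate)
open import Data.Vec.Properties using (lookup∘tabulate)
open import Function using (_∘_; id)
open import Function.Bundles using (Equivalence; mk⤖)
open import Function.Definitions using (Injective)
open import Relation.Binary.Definitions using (tri<; tri≈; tri>)
open import Relation.Binary.PropositionalEquality
open import Relation.Nullary using (¬_; Dec; yes; no; does)
open import Relation.Nullary.Decidable using (dec-true; _×-dec_; _→-dec_; ¬?; map′; toWitness)

-- The slots live on two scales: the linear ones have size proportional to `n`, the intervals only
-- to `t`, which may be a small power of `n`. Inside the middle chain every arc goes forwards, so a
-- backward arc must have an end in a linear slot. Between two linear slots a backward arc exists as
-- well, but its ends are found together, and the arcs from the leaves of one end to the other end
-- cannot be prescribed; hence the two outcomes, and two orderings to serve them. The constants are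
-- fixed in one direction: the density `M` and the number `N` are absolute, they determine the share
-- `C₀` of `n` in each linear slot, this determines `C` and `m`, and these the exponent `q`. An
-- exponent of at least `2 * C * m` makes a subset of size `n / C` lose less than a share
-- `1 / (m + 1)` of the longest chain, since `(1 + 1/m) ^ q` is then at least `2 * C`.

private variable
  U V : Set
  n : ℕ

-- Counting in lists

true≢false : true ≢ false
true≢false ()

∧-true : ∀ {a b} → a ∧ b ≡ true → a ≡ true × b ≡ true
∧-true {true} {true} _ = refl , refl

not-false : ∀ {b} → not b ≡ false → b ≡ true
not-false {true} _ = refl

≤ᵇ-true : ∀ {m n} → (m ≤ᵇ n) ≡ true → m ≤ n
≤ᵇ-true {m} {n} e = ≤ᵇ⇒≤ m n (Equivalence.from T-≡ e)

≤ᵇ-false : ∀ {m n} → (m ≤ᵇ n) ≡ false → n < m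
≤ᵇ-false {m} {n} e with m ≤? n
... | yes m≤n = ⊥-elim (true≢false (trans (sym (Equivalence.to T-≡ (≤⇒≤ᵇ m≤n))) e))
... | no m≰n = ≰⇒> m≰n

<ᵇ-true : ∀ {m n} → m < n → (m <ᵇ n) ≡ true
<ᵇ-true m<n = Equivalence.to T-≡ (<⇒<ᵇ m<n)

<ᵇ-false : ∀ {m n} → ¬ (m < n) → (m <ᵇ n) ≡ false
<ᵇ-false {m} {n} m≮n with m <ᵇ n in e
... | false = refl
... | true = ⊥-elim (m≮n (≤ᵇ-true e))

cancel : ∀ {k a b} → 0 < k → k * a ≤ k * b → a ≤ b
cancel {suc k} _ = *-cancelˡ-≤ (suc k)

cancel-< : ∀ k {a b} → k * a < k * b → a < b
cancel-< k {a} {b} = *-cancelˡ-< k a b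

nonempty : {xs : List U} → 0 < length xs → ∃ λ x → x ∈ xs
nonempty {xs = x ∷ _} _ = x , here refl

⟦_⟧ : Bool → ℕ
⟦ true ⟧ = 1
⟦ false ⟧ = 0

∑ : List U → (U → ℕ) → ℕ
∑ [] f = 0
∑ (x ∷ xs) f = f x + ∑ xs f

cnt : (U → Bool) → List U → ℕ
cnt p xs = ∑ xs (λ x → ⟦ p x ⟧)

∑-mono : ∀ (xs : List U) {f g} → (∀ x → x ∈ xs → f x ≤ g x) → ∑ xs f ≤ ∑ xs g
∑-mono [] h = z≤n
∑-mono (x ∷ xs) h = +-mono-≤ (h x (here refl)) (∑-mono xs (λ y y∈ → h y (there y∈)))

∑-const : ∀ (xs : List U) c → ∑ xs (λ _ → c) ≡ length xs * c
∑-const [] c = refl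
∑-const (_ ∷ xs) c = cong (c +_) (∑-const xs c)

∑-zero : ∀ (xs : List U) → ∑ xs (λ _ → 0) ≡ 0
∑-zero xs = trans (∑-const xs 0) (*-zeroʳ (length xs))

∑-≤-const : ∀ (xs : List U) {f} c → (∀ x → x ∈ xs → f x ≤ c) → ∑ xs f ≤ length xs * c
∑-≤-const xs c h = ≤-trans (∑-mono xs h) (≤-reflexive (∑-const xs c))

∑-+ : ∀ (xs : List U) f g → ∑ xs (λ x → f x + g x) ≡ ∑ xs f + ∑ xs g
∑-+ [] f g = refl
∑-+ (x ∷ xs) f g rewrite ∑-+ xs f g = lemma (f x) (g x) (∑ xs f) (∑ xs g)
  where
  lemma : ∀ a b c d → a + b + (c + d) ≡ a + c + (b + d)
  lemma = solve-∀

∑-* : ∀ c (xs : List U) f → ∑ xs (λ x → c * f x) ≡ c * ∑ xs f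
∑-* c [] f = sym (*-zeroʳ c)
∑-* c (x ∷ xs) f rewrite ∑-* c xs f = sym (*-distribˡ-+ c (f x) (∑ xs f))

∑-swap : ∀ (xs : List U) (ys : List V) (f : U → V → ℕ) →
  ∑ xs (λ x → ∑ ys (f x)) ≡ ∑ ys (λ y → ∑ xs (λ x → f x y))
∑-swap [] ys f = sym (∑-zero ys)
∑-swap (x ∷ xs) ys f rewrite ∑-swap xs ys f =
  sym (∑-+ ys (f x) (λ y → ∑ xs (λ x → f x y)))

cnt-mono : ∀ {p q : U → Bool} xs → (∀ x → x ∈ xs → p x ≡ true → q x ≡ true) → cnt p xs ≤ cnt q xs
cnt-mono {p = p} {q} xs h = ∑-mono xs λ x x∈ → mono (p x) (q x) (h x x∈)
  where
  mono : ∀ a b → (a ≡ true → b ≡ true) → ⟦ a ⟧ ≤ ⟦ b ⟧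
  mono false b f = z≤n
  mono true b f rewrite f refl = ≤-refl

cnt-⊆ : ∀ (p : U → Bool) {xs ys} → xs ⊆ ys → cnt p xs ≤ cnt p ys
cnt-⊆ p [] = z≤n
cnt-⊆ p (y ∷ʳ s) = ≤-trans (cnt-⊆ p s) (m≤n+m _ ⟦ p y ⟧)
cnt-⊆ p (refl ∷ s) = +-monoʳ-≤ _ (cnt-⊆ p s)

length-filterᵇ : ∀ (p : U → Bool) xs → length (filterᵇ p xs) ≡ cnt p xs
length-filterᵇ p [] = refl
length-filterᵇ p (x ∷ xs) with p x
... | true = cong suc (length-filterᵇ p xs)
... | false = length-filterᵇ p xs

filterᵇ-⊆ : ∀ (p : U → Bool) xs → filterᵇ p xs ⊆ xs
filterᵇ-⊆ p = filter-⊆ (T? ∘ p)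

∈-filterᵇ⁻ : ∀ (p : U → Bool) {x xs} → x ∈ filterᵇ p xs → x ∈ xs × p x ≡ true
∈-filterᵇ⁻ p x∈ with ∈-filter⁻ (T? ∘ p) x∈
... | x∈xs , px = x∈xs , Equivalence.to T-≡ px

∈-filterᵇ⁺ : ∀ (p : U → Bool) {x xs} → x ∈ xs → p x ≡ true → x ∈ filterᵇ p xs
∈-filterᵇ⁺ p x∈ e = ∈-filter⁺ (T? ∘ p) x∈ (Equivalence.from T-≡ e)

AllPairs-⊆ : {R : U → U → Set} {xs ys : List U} → xs ⊆ ys → AllPairs R ys → AllPairs R xs
AllPairs-⊆ [] [] = []
AllPairs-⊆ (_ ∷ʳ s) (_ ∷ rs) = AllPairs-⊆ s rs
AllPairs-⊆ (refl ∷ s) (r ∷ rs) = All.tabulate (λ x∈ → All.lookup r (⊆-lookup s x∈)) ∷ AllPairs-⊆ s rs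

cnt-split : ∀ (p : U → Bool) xs → cnt p xs + cnt (not ∘ p) xs ≡ length xs
cnt-split p xs = trans (sym (∑-+ xs _ _)) (trans (≡-∑ xs) (trans (∑-const xs 1) (*-identityʳ _)))
  where
  one : ∀ b → ⟦ b ⟧ + ⟦ not b ⟧ ≡ 1
  one true = refl
  one false = refl
  ≡-∑ : ∀ xs → ∑ xs (λ x → ⟦ p x ⟧ + ⟦ not (p x) ⟧) ≡ ∑ xs (λ _ → 1)
  ≡-∑ [] = refl
  ≡-∑ (x ∷ xs) = cong₂ _+_ (one (p x)) (≡-∑ xs)

every : (V → Bool) → List V → Bool
every p [] = true
every p (x ∷ xs) = p x ∧ every p xs

every-∈ : ∀ (p : V → Bool) {x xs} → every p xs ≡ true → x ∈ xs → p x ≡ true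
every-∈ p e (here refl) = proj₁ (∧-true e)
every-∈ p {xs = y ∷ _} e (there x∈) = every-∈ p (proj₂ (∧-true {p y} e)) x∈

every-¬ : ∀ (p : V → Bool) xs → every p xs ≡ false → ∃ λ x → x ∈ xs × p x ≡ false
every-¬ p (x ∷ xs) e with p x in px
... | false = x , here refl , px
... | true with every-¬ p xs e
...   | y , y∈ , py = y , there y∈ , py

-- Union bound: every element that fails the conjunction is charged to a condition that it violates.
cnt-every : ∀ (g : V → U → Bool) vs xs →
  length xs ≤ cnt (λ x → every (λ v → g v x) vs) xs + ∑ vs (λ v → cnt (not ∘ g v) xs)
cnt-every g [] xs = ≤-reflexive (trans (sym (*-identityʳ _)) (trans (sym (∑-const xs 1)) (sym (+-identityʳ _))))
cnt-every g (v ∷ vs) xs = begin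
  length xs                                ≤⟨ cnt-every g vs xs ⟩
  cnt E xs + S                             ≤⟨ +-monoˡ-≤ S step ⟩
  cnt (λ x → g v x ∧ E x) xs + cnt (not ∘ g v) xs + S ≡⟨ +-assoc _ (cnt (not ∘ g v) xs) S ⟩
  cnt (λ x → g v x ∧ E x) xs + (cnt (not ∘ g v) xs + S) ∎
  where
  open ≤-Reasoning
  E = λ x → every (λ v → g v x) vs
  S = ∑ vs (λ v → cnt (not ∘ g v) xs)
  bit : ∀ a b → ⟦ b ⟧ ≤ ⟦ a ∧ b ⟧ + ⟦ not a ⟧
  bit true b = m≤m+n ⟦ b ⟧ 0
  bit false true = ≤-refl
  bit false false = z≤n
  step : cnt E xs ≤ cnt (λ x → g v x ∧ E x) xs + cnt (not ∘ g v) xs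
  step = ≤-trans (∑-mono xs (λ x _ → bit (g v x) (E x))) (≤-reflexive (∑-+ xs _ _))

-- Each strict inequality between integers gains one; the summand `length vs` collects these gains,
-- so that `avoid` still has a strict bound after cancelling `k`.
∑-small : ∀ k (vs : List V) f N → (∀ v → k * f v < N) → k * ∑ vs f + length vs ≤ length vs * N
∑-small k [] f N h = ≤-reflexive (trans (+-identityʳ _) (*-zeroʳ k))
∑-small k (v ∷ vs) f N h = begin
  k * (f v + ∑ vs f) + suc (length vs)       ≡⟨ lemma k (f v) (∑ vs f) (length vs) ⟩
  suc (k * f v) + (k * ∑ vs f + length vs)   ≤⟨ +-mono-≤ (h v) (∑-small k vs f N h) ⟩
  N + length vs * N                          ∎
  where
  open ≤-Reasoning
  lemma : ∀ k a s l → k * (a + s) + suc l ≡ suc (k * a) + (k * s + l)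
  lemma = solve-∀

-- Each of the `k` conditions fails for less than a `k`-th of the list, so together they cannot
-- exclude everything. For `k = 0` the witness comes from nonemptiness.
avoid : ∀ {k} (g : Fin k → U → Bool) xs → 0 < length xs →
  (∀ v → k * cnt (not ∘ g v) xs < length xs) → ∃ λ x → x ∈ xs × (∀ v → g v x ≡ true)
avoid {k = k} g xs 0<xs few with nonempty {xs = filterᵇ E xs} (≤-trans pos (≤-reflexive (sym (length-filterᵇ E xs))))
  where
  open ≤-Reasoning
  E = λ x → every (λ v → g v x) (allFin k)
  S = ∑ (allFin k) (λ v → cnt (not ∘ g v) xs)
  small : ∀ k {vs : List (Fin k)} {s} → length vs ≡ k → k * ∑ vs s + length vs ≤ length vs * length xs →
    ∑ vs s < length xs
  small zero {[]} _ _ = 0<xs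
  small k@(suc _) {vs} {s} e le = cancel-< k (begin-strict
    k * ∑ vs s              <⟨ m<m+n (k * ∑ vs s) (subst (0 <_) (sym e) z<s) ⟩
    k * ∑ vs s + length vs  ≤⟨ le ⟩
    length vs * length xs   ≡⟨ cong (_* length xs) e ⟩
    k * length xs           ∎)
  S< : S < length xs
  S< = small k {allFin k} (length-tabulate {n = k} id)
    (∑-small k (allFin k) (λ v → cnt (not ∘ g v) xs) (length xs) few)
  pos : 0 < cnt E xs
  pos with cnt E xs in e
  ... | suc _ = z<s
  ... | zero = ⊥-elim (<⇒≱ S< (subst (λ z → length xs ≤ z + S) e (cnt-every g (allFin k) xs)))
... | x , x∈ with ∈-filterᵇ⁻ (λ x → every (λ v → g v x) (allFin k)) {xs = xs} x∈
...   | x∈xs , e = x , x∈xs , λ v → every-∈ (λ v → g v x) e (∈-allFin v)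

-- Markov's inequality for the number of R-related pairs.
light : ∀ L (R : U → V → Bool) xs ys → 0 < L → 0 < length xs →
  (∀ x → x ∈ xs → 2 * L * cnt (R x) ys ≤ length ys) →
  Σ (List V) λ zs → zs ⊆ ys × length ys ≤ 2 * length zs ×
    (∀ y → y ∈ zs → L * cnt (λ x → R x y) xs ≤ length xs)
light {U = U} {V = V} L R xs ys 0<L 0<xs few =
  filterᵇ ok ys , filterᵇ-⊆ ok ys , half , λ y y∈ → ≤ᵇ-true (proj₂ (∈-filterᵇ⁻ ok {xs = ys} y∈))
  where
  open ≤-Reasoning
  ok : V → Bool
  ok y = L * cnt (λ x → R x y) xs ≤ᵇ length xs
  heavy : ∀ b {m n} → b ≡ (m ≤ᵇ n) → n * ⟦ not b ⟧ ≤ m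
  heavy true {m} {n} e = ≤-trans (≤-reflexive (*-zeroʳ n)) z≤n
  heavy false {m} {n} e = ≤-trans (≤-reflexive (*-identityʳ n)) (<⇒≤ (≤ᵇ-false (sym e)))
  H = cnt (not ∘ ok) ys
  double : length xs * (2 * H) ≤ length xs * length ys
  double = begin
    length xs * (2 * H)  ≡⟨ sw (length xs) H ⟩
    2 * (length xs * H) ≡⟨ cong (2 *_) (sym (∑-* (length xs) ys _)) ⟩
    2 * ∑ ys (λ y → length xs * ⟦ not (ok y) ⟧) ≤⟨ *-monoʳ-≤ 2 (∑-mono ys (λ y _ → heavy (ok y) refl)) ⟩
    2 * ∑ ys (λ y → L * cnt (λ x → R x y) xs) ≡⟨ cong (2 *_) (∑-* L ys _) ⟩
    2 * (L * ∑ ys (λ y → cnt (λ x → R x y) xs)) ≡⟨ cong (λ z → 2 * (L * z)) (∑-swap ys xs _) ⟩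
    2 * (L * ∑ xs (λ x → cnt (R x) ys)) ≡⟨ sym (*-assoc 2 L _) ⟩
    2 * L * ∑ xs (λ x → cnt (R x) ys) ≡⟨ sym (∑-* (2 * L) xs _) ⟩
    ∑ xs (λ x → 2 * L * cnt (R x) ys) ≤⟨ ∑-≤-const xs (length ys) few ⟩
    length xs * length ys ∎
    where
    sw : ∀ a b → a * (2 * b) ≡ 2 * (a * b)
    sw = solve-∀
  half : length ys ≤ 2 * length (filterᵇ ok ys)
  half = +-cancelʳ-≤ (length ys) _ _ (begin
    length ys + length ys ≡⟨ cong₂ _+_ (sym (cnt-split ok ys)) (sym (cnt-split ok ys)) ⟩
    cnt ok ys + H + (cnt ok ys + H) ≡⟨ rearr (cnt ok ys) H ⟩
    2 * cnt ok ys + 2 * H ≤⟨ +-monoʳ-≤ (2 * cnt ok ys) (cancel 0<xs double) ⟩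
    2 * cnt ok ys + length ys ≡⟨ cong (λ z → 2 * z + length ys) (sym (length-filterᵇ ok ys)) ⟩
    2 * length (filterᵇ ok ys) + length ys ∎)
    where
    rearr : ∀ a b → a + b + (a + b) ≡ 2 * a + 2 * b
    rearr = solve-∀

-- Cutting lists into intervals of equal length

block : ∀ {h} → ℕ → List U → Fin h → List U
block r xs zero = take r xs
block r xs (suc i) = block r (drop r xs) i

block-⊆ : ∀ {h} r (xs : List U) (i : Fin h) → block r xs i ⊆ xs
block-⊆ r xs zero = take-⊆ r xs
block-⊆ r xs (suc i) = ⊆-trans (block-⊆ r (drop r xs) i) (drop-⊆ r xs)

block-length : ∀ {h} r (xs : List U) (i : Fin h) → h * r ≤ length xs → length (block r xs i) ≡ r
block-length {h = suc h} r xs zero le = trans (length-take r xs) (m≤n⇒m⊓n≡m (≤-trans (m≤m+n r (h * r)) le))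
block-length {h = suc h} r xs (suc i) le = block-length r (drop r xs) i
  (subst (h * r ≤_) (sym (length-drop r xs)) (m+n≤o⇒n≤o∸m r le))
  where
  m+n≤o⇒n≤o∸m : ∀ m {n o} → m + n ≤ o → n ≤ o ∸ m
  m+n≤o⇒n≤o∸m m {n} le = subst (_≤ _) (m+n∸m≡n m n) (∸-monoˡ-≤ m le)

take-drop-related : {R : U → U → Set} → ∀ r {xs : List U} → AllPairs R xs →
  ∀ {x y} → x ∈ take r xs → y ∈ drop r xs → R x y
take-drop-related (suc r) {x ∷ xs} (a ∷ _) (here refl) y∈ = All.lookup a (⊆-lookup (drop-⊆ r xs) y∈)
take-drop-related (suc r) {x ∷ xs} (_ ∷ as) (there x∈) y∈ = take-drop-related r as x∈ y∈

block-related : ∀ {h} {R : U → U → Set} r {xs : List U} → AllPairs R xs →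
  ∀ {i j : Fin h} → i Fin.< j → ∀ {x y} → x ∈ block r xs i → y ∈ block r xs j → R x y
block-related r {xs} as {zero} {suc j} _ x∈ y∈ = take-drop-related r as x∈ (⊆-lookup (block-⊆ r (drop r xs) j) y∈)
block-related r {xs} as {suc i} {suc j} (s≤s lt) x∈ y∈ = block-related r (AllPairs-⊆ (drop-⊆ r xs) as) lt x∈ y∈

-- Rounding `n / h` down loses at most a factor 2: since `r ≥ 1`, `n < h * (r + 1) ≤ 2 * h * r`.
block-size : ∀ h c n → 0 < h → 0 < c → h * c ≤ n → ∃ λ r → c ≤ r × h * r ≤ n × n ≤ 2 * h * r
block-size h@(suc _) c n _ 0<c le = n / h , c≤r , hr≤n , n≤
  where
  open ≤-Reasoning
  r = n / h
  eq : n ≡ n % h + r * h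
  eq = m≡m%n+[m/n]*n n h
  hr≤n : h * r ≤ n
  hr≤n = begin
    h * r ≡⟨ *-comm h r ⟩
    r * h ≤⟨ m≤n+m (r * h) (n % h) ⟩
    n % h + r * h ≡⟨ sym eq ⟩
    n ∎
  n<  : n < h * suc r
  n< = begin-strict
    n ≡⟨ eq ⟩
    n % h + r * h <⟨ +-monoˡ-< (r * h) (m%n<n n h) ⟩
    h + r * h ≡⟨ *-comm (suc r) h ⟩
    h * suc r ∎
  c≤r : c ≤ r
  c≤r = s≤s⁻¹ (cancel-< h (≤-<-trans le n<))
  n≤ : n ≤ 2 * h * r
  n≤ = begin
    n ≤⟨ <⇒≤ n< ⟩
    h * suc r ≡⟨ *-suc h r ⟩
    h + h * r ≤⟨ +-monoˡ-≤ (h * r) (≤-trans (≤-reflexive (sym (*-identityʳ h))) (*-monoʳ-≤ h (≤-trans 0<c c≤r))) ⟩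
    h * r + h * r ≡⟨ dbl h r ⟩
    2 * h * r ∎
    where
    dbl : ∀ a b → a * b + a * b ≡ 2 * a * b
    dbl = solve-∀

-- Dense pairs in tournaments without H

-- With the direction as an argument, a prescribed adjacency `H u v` of either value becomes the
-- single positive condition `arc T (H u v) x y ≡ true`.
arc : Digraph n → Bool → Fin n → Fin n → Bool
arc T true x y = T x y
arc T false x y = T y x

module Tournament {n} {T : Digraph n} (tour : IsTournament T) where
  open IsTournament tour public

  arc⇒≢ : ∀ {x y} → T x y ≡ true → x ≢ y
  arc⇒≢ {x} e refl = true≢false (trans (sym e) (irrefl x))

  flip-true : ∀ {x y} → T x y ≡ true → T y x ≡ false
  flip-true {x} {y} e = trans (total y x (arc⇒≢ e ∘ sym)) (cong not e)

  flip-false : ∀ {x y} → x ≢ y → T x y ≡ false → T y x ≡ true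
  flip-false {x} {y} x≢y e = trans (total y x (x≢y ∘ sym)) (cong not e)

  not-arc : ∀ b {x y} → x ≢ y → arc T b x y ≡ false → arc T (not b) x y ≡ true
  not-arc true = flip-false
  not-arc false x≢y = flip-false (x≢y ∘ sym)

-- Embedding vertex by vertex fails only when, for some i and j, many candidates for i have
-- few neighbours of the wanted kind among the candidates for j.
greedy : ∀ h (H : Digraph h) M → 0 < M → Σ ℕ λ C → 0 < C × (∀ {n} (T : Digraph n) (X : Fin h → List (Fin n)) →
  (∀ v → C ≤ length (X v)) →
  (Σ (Fin h → Fin n) λ f → (∀ v → f v ∈ X v) × (∀ u v → u Fin.< v → arc T (H u v) (f u) (f v) ≡ true))
  ⊎ (∃₂ λ i j → i ≢ j × ∃₂ λ A B → A ⊆ X i × B ⊆ X j × length (X i) ≤ C * length A × length (X j) ≤ C * length B ×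
      Σ Bool λ b → ∀ a → a ∈ A → M * cnt (arc T b a) B ≤ length B))
greedy zero H M _ = 1 , z<s , λ T X _ → inj₁ ((λ ()) , (λ ()) , λ ())
greedy (suc h) H M 0<M with greedy h (λ u v → H (suc u) (suc v)) M 0<M
... | C , 0<C , rec = C' , z<s , go
  where
  open ≤-Reasoning
  -- The 1 keeps `X zero` nonempty, `h` pays for passing to a bad `h`-th of `X zero`, and `M * C`
  -- for passing to neighbourhoods before the recursive call.
  C' = suc (h + M * C)
  h≤C' : h ≤ C'
  h≤C' = m≤n⇒m≤1+n (m≤m+n h (M * C))
  MC≤C' : M * C ≤ C'
  MC≤C' = m≤n⇒m≤1+n (m≤n+m (M * C) h)
  go : ∀ {n} (T : Digraph n) (X : Fin (suc h) → List (Fin n)) → (∀ v → C' ≤ length (X v)) → _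
  -- Either for some `j` at least an `h`-th of `X zero` has few wanted neighbours in `X (suc j)`,
  -- which is the sparse pair, or the bad sets do not cover `X zero` and some vertex is rich towards
  -- all later sets.
  go {n} T X big with any? (λ j → length (X zero) ≤? h * cnt (not ∘ rich j) (X zero))
    where
    rich : Fin h → Fin n → Bool
    rich j a = length (X (suc j)) <ᵇ M * cnt (arc T (H zero (suc j)) a) (X (suc j))
  ... | yes (j , le) = inj₂ (zero , suc j , (λ ()) , A , X (suc j) , filterᵇ-⊆ _ (X zero) , ⊆-refl ,
          A-big , ≤-trans (≤-reflexive (sym (*-identityˡ _))) (*-monoˡ-≤ _ {1} {C'} (s≤s z≤n)) , H zero (suc j) , sparse)
    where
    A = filterᵇ _ (X zero)
    A-big : length (X zero) ≤ C' * length A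
    A-big = begin
      length (X zero)  ≤⟨ le ⟩
      h * _            ≡⟨ cong (h *_) (sym (length-filterᵇ _ (X zero))) ⟩
      h * length A     ≤⟨ *-monoˡ-≤ (length A) h≤C' ⟩
      C' * length A    ∎
    sparse : ∀ a → a ∈ A → M * cnt (arc T (H zero (suc j)) a) (X (suc j)) ≤ length (X (suc j))
    sparse a a∈ with ∈-filterᵇ⁻ _ {xs = X zero} a∈
    ... | _ , e = ≮⇒≥ (λ lt → true≢false (trans (sym e) (cong not (<ᵇ-true lt))))
  ... | no none with avoid _ (X zero) (≤-trans z<s (big zero)) (λ j → ≰⇒> (λ le → none (j , le)))
  ...   | a , a∈ , good with rec T Y Y-big
    where
    p : Fin h → Fin n → Bool
    p j = arc T (H zero (suc j)) a
    Y : Fin h → List (Fin n)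
    Y j = filterᵇ (p j) (X (suc j))
    X≤Y : ∀ j → length (X (suc j)) ≤ M * length (Y j)
    X≤Y j = begin
      length (X (suc j))         ≤⟨ <⇒≤ (≤ᵇ-true (good j)) ⟩
      M * cnt (p j) (X (suc j))  ≡⟨ cong (M *_) (sym (length-filterᵇ (p j) (X (suc j)))) ⟩
      M * length (Y j)           ∎
    Y-big : ∀ j → C ≤ length (Y j)
    Y-big j = cancel 0<M (≤-trans MC≤C' (≤-trans (big (suc j)) (X≤Y j)))
  ...     | inj₁ (f , f∈ , arcs) = inj₁ (g , g∈ , g-arcs)
    where
    g : Fin (suc h) → Fin n
    g zero = a
    g (suc v) = f v
    f∈′ : ∀ v → f v ∈ X (suc v) × arc T (H zero (suc v)) a (f v) ≡ true
    f∈′ v = ∈-filterᵇ⁻ _ {xs = X (suc v)} (f∈ v)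
    g∈ : ∀ v → g v ∈ X v
    g∈ zero = a∈
    g∈ (suc v) = proj₁ (f∈′ v)
    g-arcs : ∀ u v → u Fin.< v → arc T (H u v) (g u) (g v) ≡ true
    g-arcs zero (suc v) _ = proj₂ (f∈′ v)
    g-arcs (suc u) (suc v) (s≤s u<v) = arcs u v u<v
  ...     | inj₂ (i , j , i≢j , A , B , A⊆ , B⊆ , A-big , B-big , b , sparse) =
    inj₂ (suc i , suc j , (λ { refl → i≢j refl }) , A , B , ⊆-trans A⊆ (filterᵇ-⊆ _ (X (suc i))) , ⊆-trans B⊆ (filterᵇ-⊆ _ (X (suc j))) ,
          up i A-big , up j B-big , b , sparse)
    where
    up : ∀ i {k} → length (filterᵇ (arc T (H zero (suc i)) a) (X (suc i))) ≤ C * k → length (X (suc i)) ≤ C' * k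
    up i {k} le = begin
      length (X (suc i))                              ≤⟨ <⇒≤ (≤ᵇ-true (good i)) ⟩
      M * cnt (arc T (H zero (suc i)) a) (X (suc i))  ≡⟨ cong (M *_) (sym (length-filterᵇ _ (X (suc i)))) ⟩
      M * length (filterᵇ (arc T (H zero (suc i)) a) (X (suc i)))  ≤⟨ *-monoʳ-≤ M le ⟩
      M * (C * k)                                     ≡⟨ sym (*-assoc M C k) ⟩
      M * C * k                                       ≤⟨ *-monoˡ-≤ k MC≤C' ⟩
      C' * k                                          ∎

Dense : Digraph n → ℕ → List (Fin n) → List (Fin n) → Set
Dense T M X Y =
  (∀ x → x ∈ X → M * cnt (λ y → not (T x y)) Y ≤ length Y) ×
  (∀ y → y ∈ Y → M * cnt (λ x → not (T x y)) X ≤ length X)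

Apart : List (Fin n) → List (Fin n) → Set
Apart X Y = ∀ x y → x ∈ X → y ∈ Y → x ≢ y

-- Between tournaments, preserving arcs already gives an induced copy: a non-arc between distinct
-- vertices is a reversed arc, and a loopless target makes the map injective.
Embeds : Digraph n → ∀ {h} → Digraph h → Set
Embeds {n} T {h} H = Σ (Fin h → Fin n) λ f → ∀ {u v} → H u v ≡ true → T (f u) (f v) ≡ true

ordered-arcs : ∀ {h} {H : Digraph h} {T : Digraph n} → IsTournament H → (f : Fin h → Fin n) →
  (∀ u v → u Fin.< v → arc T (H u v) (f u) (f v) ≡ true) → ∀ {u v} → H u v ≡ true → T (f u) (f v) ≡ true
ordered-arcs {H = H} {T} tour f arcs {u} {v} e with Finₚ.<-cmp u v
... | tri< u<v _ _ = subst (λ b → arc T b (f u) (f v) ≡ true) e (arcs u v u<v)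
... | tri≈ _ u≡v _ = ⊥-elim (Tournament.arc⇒≢ tour e u≡v)
... | tri> _ _ v<u = subst (λ b → arc T b (f v) (f u) ≡ true) (Tournament.flip-true tour e) (arcs v u v<u)

DenseParts : ∀ {h} → Digraph h → ℕ → ℕ → ℕ → Set
DenseParts H M k C = ∀ {n} {T : Digraph n} → IsTournament T → ¬ Embeds T H → ∀ A → Unique A → C ≤ length A →
  Σ (Fin k → List (Fin n)) λ P → (∀ i → P i ⊆ A × length A ≤ C * length (P i)) ×
    (∀ i j → i Fin.< j → Apart (P i) (P j) × Dense T M (P i) (P j))

module _ {h} {H : Digraph h} (Htour : IsTournament H) (0<h : 0 < h) where

  -- A failure of `greedy` on blocks of `A` is sparse as seen from `X` only; `light` keeps half of
  -- `Y` to make it sparse from both sides. Relative counts may double when `Y` is halved, hence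
  -- `2 * M`. In `4 * h * C₁` one factor 2 comes from rounding the block size, the other from the
  -- halving.
  densePair : ∀ M → 0 < M → Σ ℕ λ C → 0 < C × (∀ {n} {T : Digraph n} → IsTournament T → ¬ Embeds T H →
    ∀ A → Unique A → C ≤ length A →
    ∃₂ λ X Y → X ⊆ A × Y ⊆ A × length A ≤ C * length X × length A ≤ C * length Y × Apart X Y × Dense T M X Y)
  densePair M 0<M with greedy h H (2 * M) (≤-trans 0<M (m≤m+n M _))
  ... | C₁ , 0<C₁ , G = C , 0<C , go
    where
    open ≤-Reasoning
    C = 4 * h * C₁
    0<C : 0 < C
    0<C = *-mono-≤ {1} {4 * h} (*-mono-≤ {1} {4} (s≤s z≤n) 0<h) 0<C₁
    hC₁≤C : h * C₁ ≤ C
    hC₁≤C = *-monoˡ-≤ C₁ (m≤m+n h (3 * h))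
    go : ∀ {n} {T : Digraph n} → IsTournament T → ¬ Embeds T H → ∀ A → Unique A → C ≤ length A → _
    go {n} {T} tour free A uniq big with block-size h C₁ (length A) 0<h 0<C₁ (≤-trans hC₁≤C big)
    ... | r , C₁≤r , hr≤ , A≤ with G T (block r A) (λ v → ≤-trans C₁≤r (≤-reflexive (sym (block-length r A v hr≤))))
    ...   | inj₁ (f , _ , arcs) = ⊥-elim (free (f , ordered-arcs Htour f arcs))
    ...   | inj₂ (i , j , i≢j , X , Y , X⊆ , Y⊆ , X-big , Y-big , b , sparse) = orient b sparse
      where
      open Tournament tour
      block≤ : ∀ i {k} → length (block r A i) ≤ C₁ * k → length A ≤ 2 * h * (C₁ * k)
      block≤ i {k} le = ≤-trans A≤ (*-monoʳ-≤ (2 * h) (subst (_≤ C₁ * k) (block-length r A i hr≤) le))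
      X≤ : length A ≤ C * length X
      X≤ = begin
        length A                    ≤⟨ block≤ i X-big ⟩
        2 * h * (C₁ * length X)     ≤⟨ *-monoˡ-≤ (C₁ * length X) (*-monoˡ-≤ h (s≤s (s≤s (z≤n {2})))) ⟩
        4 * h * (C₁ * length X)     ≡⟨ sym (*-assoc (4 * h) C₁ _) ⟩
        C * length X                ∎
      XA : X ⊆ A
      XA = ⊆-trans X⊆ (block-⊆ r A i)
      YA : Y ⊆ A
      YA = ⊆-trans Y⊆ (block-⊆ r A j)
      apart : Apart X Y
      apart x y x∈ y∈ with Finₚ.<-cmp i j
      ... | tri< lt _ _ = block-related r uniq lt (⊆-lookup X⊆ x∈) (⊆-lookup Y⊆ y∈)
      ... | tri≈ _ e _ = ⊥-elim (i≢j e)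
      ... | tri> _ _ gt = block-related r uniq gt (⊆-lookup Y⊆ y∈) (⊆-lookup X⊆ x∈) ∘ sym
      0<X : 0 < length X
      0<X with length X | X≤
      ... | suc _ | _ = z<s
      ... | zero | le = ⊥-elim (<⇒≱ (<-≤-trans 0<C big) (≤-trans le (≤-reflexive (*-zeroʳ C))))
      turn : ∀ b {x y} → x ≢ y → not (arc T (not b) x y) ≡ true → arc T b x y ≡ true
      turn b {x} {y} x≢y e with arc T (not b) x y in eq
      turn true x≢y e | false = not-arc false x≢y eq
      turn false x≢y e | false = not-arc true x≢y eq
      orient : ∀ b → (∀ a → a ∈ X → 2 * M * cnt (arc T b a) Y ≤ length Y) → _
      orient b sparse with light M (λ x y → not (arc T (not b) x y)) X Y 0<M 0<X few
        where
        few : ∀ x → x ∈ X → 2 * M * cnt (λ y → not (arc T (not b) x y)) Y ≤ length Y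
        few x x∈ = ≤-trans (*-monoʳ-≤ (2 * M) (cnt-mono Y (λ y y∈ → turn b (apart x y x∈ y∈)))) (sparse x x∈)
      ... | Z , Z⊆ , Y≤Z , lightZ = final b refl
        where
        Z≤ : length A ≤ C * length Z
        Z≤ = begin
          length A                    ≤⟨ block≤ j Y-big ⟩
          2 * h * (C₁ * length Y)     ≤⟨ *-monoʳ-≤ (2 * h) (*-monoʳ-≤ C₁ Y≤Z) ⟩
          2 * h * (C₁ * (2 * length Z)) ≡⟨ lemma h C₁ (length Z) ⟩
          C * length Z                ∎
          where
          lemma : ∀ a b c → 2 * a * (b * (2 * c)) ≡ 4 * a * b * c
          lemma = solve-∀
        ZA : Z ⊆ A
        ZA = ⊆-trans Z⊆ YA
        apartZ : Apart X Z
        apartZ x z x∈ z∈ = apart x z x∈ (⊆-lookup Z⊆ z∈)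
        fewZ : ∀ x → x ∈ X → M * cnt (λ y → not (arc T (not b) x y)) Z ≤ length Z
        fewZ x x∈ = cancel {2} z<s (begin
          2 * (M * cnt (q x) Z)  ≡⟨ sym (*-assoc 2 M _) ⟩
          2 * M * cnt (q x) Z    ≤⟨ *-monoʳ-≤ (2 * M) (cnt-⊆ (q x) Z⊆) ⟩
          2 * M * cnt (q x) Y    ≤⟨ *-monoʳ-≤ (2 * M) (cnt-mono Y (λ y y∈ → turn b (apart x y x∈ y∈))) ⟩
          2 * M * cnt (arc T b x) Y  ≤⟨ sparse x x∈ ⟩
          length Y               ≤⟨ Y≤Z ⟩
          2 * length Z           ∎)
          where
          q = λ x y → not (arc T (not b) x y)
        final : ∀ c → c ≡ b → _
        -- Arcs from `X` to `Z` are the rare ones here, so the dense direction runs from `Z` to `X`.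
        final true refl = Z , X , ZA , XA , Z≤ , X≤ , (λ z x z∈ x∈ → apartZ x z x∈ z∈ ∘ sym) , lightZ , fewZ
        final false refl = X , Z , XA , ZA , X≤ , Z≤ , apartZ , fewZ , lightZ

  -- One part is split off and the others are found inside `Y`, each filling at least a `C`-th of
  -- it; density `M * C` towards `Y` therefore leaves density `M` towards each of them.
  denseParts : ∀ M → 0 < M → ∀ k → Σ ℕ λ C → 0 < C × DenseParts H M k C
  denseParts M 0<M zero = 1 , z<s , λ _ _ _ _ _ → (λ ()) , (λ ()) , λ ()
  denseParts M 0<M (suc k) with denseParts M 0<M k
  ... | C , 0<C , rec with densePair (M * C) (*-mono-≤ 0<M 0<C)
  ...   | D , 0<D , pair = D * C , *-mono-≤ 0<D 0<C , go
    where
    open ≤-Reasoning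
    go : ∀ {n} {T : Digraph n} → IsTournament T → ¬ Embeds T H → ∀ A → Unique A → D * C ≤ length A → _
    go {n} {T} tour free A uniq big with pair tour free A uniq (≤-trans (m≤m*n D C {{>-nonZero 0<C}}) big)
    ... | X , Y , X⊆ , Y⊆ , X-big , Y-big , apart , denseˡ , denseʳ
        with rec tour free Y (AllPairs-⊆ Y⊆ uniq) (cancel 0<D (≤-trans big Y-big))
    ...   | P , P-big , P-dense = Q , Q-big , Q-dense
      where
      Q : Fin (suc k) → List (Fin n)
      Q zero = X
      Q (suc i) = P i
      Q-big : ∀ i → Q i ⊆ A × length A ≤ D * C * length (Q i)
      Q-big zero = X⊆ , (begin
        length A           ≤⟨ X-big ⟩
        D * length X       ≤⟨ *-monoˡ-≤ (length X) (m≤m*n D C {{>-nonZero 0<C}}) ⟩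
        D * C * length X   ∎)
      Q-big (suc i) = ⊆-trans (proj₁ (P-big i)) Y⊆ , (begin
        length A                ≤⟨ Y-big ⟩
        D * length Y            ≤⟨ *-monoʳ-≤ D (proj₂ (P-big i)) ⟩
        D * (C * length (P i))  ≡⟨ sym (*-assoc D C _) ⟩
        D * C * length (P i)    ∎)
      Q-dense : ∀ i j → i Fin.< j → Apart (Q i) (Q j) × Dense T M (Q i) (Q j)
      Q-dense zero (suc j) _ = (λ x y x∈ y∈ → apart x y x∈ (⊆-lookup Pj⊆ y∈)) ,
        (λ x x∈ → cancel 0<C (begin
          C * (M * cnt (q x) (P j))  ≡⟨ comm C M _ ⟩
          M * C * cnt (q x) (P j)    ≤⟨ *-monoʳ-≤ (M * C) (cnt-⊆ (q x) Pj⊆) ⟩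
          M * C * cnt (q x) Y        ≤⟨ denseˡ x x∈ ⟩
          length Y                   ≤⟨ proj₂ (P-big j) ⟩
          C * length (P j)           ∎)) ,
        (λ y y∈ → begin
          M * cnt (λ x → q x y) X      ≤⟨ *-monoˡ-≤ _ (m≤m*n M C {{>-nonZero 0<C}}) ⟩
          M * C * cnt (λ x → q x y) X  ≤⟨ denseʳ y (⊆-lookup Pj⊆ y∈) ⟩
          length X                     ∎)
        where
        Pj⊆ = proj₁ (P-big j)
        q = λ x y → not (T x y)
        comm : ∀ a b c → a * (b * c) ≡ b * a * c
        comm = solve-∀
      Q-dense (suc i) (suc j) (s≤s lt) = P-dense i j lt

-- Slots

Chain : Digraph n → List (Fin n) → Set
Chain T = AllPairs (λ x y → T x y ≡ true)

-- The inequality in `long` is `length l > (1 - 1/m) t`, written without subtraction or division.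
record Critical (T : Digraph n) (t C m : ℕ) : Set where
  field
    short : ∀ l → Chain T l → length l ≤ t
    long  : ∀ A → Unique A → n ≤ C * length A →
      Σ (List (Fin n)) λ l → Chain T l × (∀ x → x ∈ l → x ∈ A) × m * t < m * length l + t

-- lin i is the i-th of the six parts around the middle one; mid j is the j-th interval of a transitive
-- subset of the middle part.
data Slot : Set where
  lin : Fin 6 → Slot
  mid : Fin 24 → Slot

part : Fin 6 → Fin 7
part = punchIn (# 3)

before : Slot → Slot → Bool
before (lin i) (lin j) = toℕ (part i) <ᵇ toℕ (part j)
before (lin i) (mid _) = toℕ (part i) <ᵇ 3
before (mid _) (lin j) = 3 <ᵇ toℕ (part j)
before (mid i) (mid j) = toℕ i <ᵇ toℕ j

record Family (T : Digraph n) (M N t C : ℕ) : Set where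
  field
    X       : Slot → List (Fin n)
    apart   : ∀ a b → a ≢ b → Apart (X a) (X b)
    dense   : ∀ a b → before a b ≡ true → Dense T M (X a) (X b)
    mids    : ∀ i j → i Fin.< j → ∀ x y → x ∈ X (mid i) → y ∈ X (mid j) → T x y ≡ true
    unique  : ∀ i → Unique (X (lin i))
    chain   : ∀ j → Chain T (X (mid j))
    lin-big : ∀ i → n ≤ C * length (X (lin i))
    mid-big : ∀ j → t ≤ 2 * N * length (X (mid j))

module Refine {n} {T : Digraph n} (tour : IsTournament T) (M N : ℕ) (0<M : 0 < M) (0<N : 0 < N)
  (P : Fin 7 → List (Fin n))
  (P-rel : ∀ i j → i Fin.< j → Apart (P i) (P j) × Dense T (2 * (N * M)) (P i) (P j))
  (S : List (Fin n)) (0<S : 0 < length S) (S∈ : ∀ s → s ∈ S → s ∈ P (# 3))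
  (B : Fin 24 → List (Fin n)) (B⊆ : ∀ j → B j ⊆ S) (S≤ : ∀ j → length S ≤ N * length (B j))
  (B-chain : ∀ i j → i Fin.< j → ∀ x y → x ∈ B i → y ∈ B j → T x y ≡ true) where

  open ≤-Reasoning
  open Tournament tour

  -- A share `1 / (N * M)` of `S` is at most a share `1 / M` of any interval, as
  -- `length S ≤ N * length (B j)`.
  L₀ : ℕ
  L₀ = N * M

  M≤L₀ : M ≤ L₀
  M≤L₀ = m≤n*m M N {{>-nonZero 0<N}}

  P-apart : ∀ i j → i ≢ j → Apart (P i) (P j)
  P-apart i j i≢j x y x∈ y∈ with Finₚ.<-cmp i j
  ... | tri< lt _ _ = proj₁ (P-rel i j lt) x y x∈ y∈
  ... | tri≈ _ e _ = ⊥-elim (i≢j e)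
  ... | tri> _ _ gt = proj₁ (P-rel j i gt) y x y∈ x∈ ∘ sym

  -- T v s, read in the direction in which P i and the middle part are dense.
  toS : Fin 6 → Fin n → Fin n → Bool
  toS i v s = arc T (toℕ (part i) <ᵇ 3) v s
  -- `S` may be a tiny subset of the middle part, so the density of a vertex of `P (part i)` towards
  -- that part says nothing about `S`. The density of the vertices of `S` towards `P (part i)` does
  -- survive, and double counting returns it to half of the vertices of `P (part i)`.
  refine : ∀ i → Σ (List (Fin n)) λ Z → Z ⊆ P (part i) × length (P (part i)) ≤ 2 * length Z ×
    (∀ v → v ∈ Z → L₀ * cnt (λ s → not (toS i v s)) S ≤ length S)
  refine i = light L₀ (λ s v → not (toS i v s)) S (P (part i)) (≤-trans 0<M M≤L₀) 0<S λ s s∈ → few s (S∈ s s∈)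
    where
    few : ∀ s → s ∈ P (# 3) → 2 * L₀ * cnt (λ v → not (toS i v s)) (P (part i)) ≤ length (P (part i))
    few s s∈ with Finₚ.<-cmp (part i) (# 3)
    ... | tri< lt _ _ = subst (λ b → 2 * L₀ * cnt (λ v → not (arc T b v s)) (P (part i)) ≤ length (P (part i))) (sym (<ᵇ-true lt))
            (proj₂ (proj₂ (P-rel (part i) (# 3) lt)) s s∈)
    ... | tri≈ _ e _ = ⊥-elim (punchInᵢ≢i (# 3) i e)
    ... | tri> ≮ _ gt = subst (λ b → 2 * L₀ * cnt (λ v → not (arc T b v s)) (P (part i)) ≤ length (P (part i))) (sym (<ᵇ-false ≮))
            (proj₁ (proj₂ (P-rel (# 3) (part i) gt)) s s∈)
  Z : Fin 6 → List (Fin n)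
  Z i = proj₁ (refine i)
  Z⊆ : ∀ i → Z i ⊆ P (part i)
  Z⊆ i = proj₁ (proj₂ (refine i))
  Z-half : ∀ i → length (P (part i)) ≤ 2 * length (Z i)
  Z-half i = proj₁ (proj₂ (proj₂ (refine i)))
  X : Slot → List (Fin n)
  X (lin i) = Z i
  X (mid j) = B j
  X-apart : ∀ a b → a ≢ b → Apart (X a) (X b)
  X-apart (lin i) (lin j) ne x y x∈ y∈ =
    P-apart (part i) (part j) (ne ∘ cong lin ∘ punchIn-injective (# 3) i j) x y (⊆-lookup (Z⊆ i) x∈) (⊆-lookup (Z⊆ j) y∈)
  X-apart (lin i) (mid j) _ x y x∈ y∈ =
    P-apart (part i) (# 3) (punchInᵢ≢i (# 3) i) x y (⊆-lookup (Z⊆ i) x∈) (S∈ y (⊆-lookup (B⊆ j) y∈))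
  X-apart (mid i) (lin j) _ x y x∈ y∈ =
    P-apart (part j) (# 3) (punchInᵢ≢i (# 3) j) y x (⊆-lookup (Z⊆ j) y∈) (S∈ x (⊆-lookup (B⊆ i) x∈)) ∘ sym
  X-apart (mid i) (mid j) ne x y x∈ y∈ with Finₚ.<-cmp i j
  ... | tri< lt _ _ = arc⇒≢ (B-chain i j lt x y x∈ y∈)
  ... | tri≈ _ e _ = ⊥-elim (ne (cong mid e))
  ... | tri> _ _ gt = arc⇒≢ (B-chain j i gt y x y∈ x∈) ∘ sym
  Z-to-B : ∀ i j v → v ∈ Z i → M * cnt (λ s → not (toS i v s)) (B j) ≤ length (B j)
  Z-to-B i j v v∈ = cancel 0<N (begin
    N * (M * cnt q (B j))    ≡⟨ sym (*-assoc N M _) ⟩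
    L₀ * cnt q (B j)         ≤⟨ *-monoʳ-≤ L₀ (cnt-⊆ q (B⊆ j)) ⟩
    L₀ * cnt q S             ≤⟨ proj₂ (proj₂ (proj₂ (refine i))) v v∈ ⟩
    length S                 ≤⟨ S≤ j ⟩
    N * length (B j)         ∎)
    where
    q = λ s → not (toS i v s)
  shrunk : ∀ i {p : Fin n → Bool} → 2 * L₀ * cnt p (P (part i)) ≤ length (P (part i)) → M * cnt p (Z i) ≤ length (Z i)
  shrunk i {p} le = cancel {2} z<s (begin
    2 * (M * cnt p (Z i))       ≡⟨ sym (*-assoc 2 M _) ⟩
    2 * M * cnt p (Z i)         ≤⟨ *-monoʳ-≤ (2 * M) (cnt-⊆ p (Z⊆ i)) ⟩
    2 * M * cnt p (P (part i))  ≤⟨ *-monoˡ-≤ (cnt p (P (part i))) (*-monoʳ-≤ 2 M≤L₀) ⟩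
    2 * L₀ * cnt p (P (part i))  ≤⟨ le ⟩
    length (P (part i))          ≤⟨ Z-half i ⟩
    2 * length (Z i)             ∎)
  X-dense : ∀ a b → before a b ≡ true → Dense T M (X a) (X b)
  X-dense (lin i) (lin j) e with P-rel (part i) (part j) (≤ᵇ-true e)
  ... | _ , dˡ , dʳ = (λ x x∈ → shrunk j (dˡ x (⊆-lookup (Z⊆ i) x∈))) , (λ y y∈ → shrunk i (dʳ y (⊆-lookup (Z⊆ j) y∈)))
  X-dense (lin i) (mid j) e =
    (λ x x∈ → subst (λ b → M * cnt (λ s → not (arc T b x s)) (B j) ≤ length (B j)) e (Z-to-B i j x x∈)) ,
    (λ y y∈ → shrunk i (proj₂ (proj₂ (P-rel (part i) (# 3) (≤ᵇ-true e))) y (S∈ y (⊆-lookup (B⊆ j) y∈))))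
  X-dense (mid j) (lin i) e =
    (λ y y∈ → shrunk i (proj₁ (proj₂ (P-rel (# 3) (part i) (≤ᵇ-true e))) y (S∈ y (⊆-lookup (B⊆ j) y∈)))) ,
    (λ x x∈ → subst (λ b → M * cnt (λ s → not (arc T b x s)) (B j) ≤ length (B j)) (<ᵇ-false {toℕ (part i)} {3} (<-asym (≤ᵇ-true e))) (Z-to-B i j x x∈))
  X-dense (mid i) (mid j) e =
    (λ x x∈ → none (λ y y∈ → cong not (B-chain i j (≤ᵇ-true e) x y x∈ y∈))) ,
    (λ y y∈ → none (λ x x∈ → cong not (B-chain i j (≤ᵇ-true e) x y x∈ y∈)))
    where
    none : ∀ {p : Fin n → Bool} {xs} → (∀ x → x ∈ xs → p x ≡ false) → M * cnt p xs ≤ length xs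
    none {p} {xs} h = ≤-trans (≤-trans (*-monoʳ-≤ M (≤-trans (∑-mono xs {g = λ _ → 0} (λ x x∈ → ≤-reflexive (cong ⟦_⟧ (h x x∈)))) (≤-reflexive (∑-zero xs)))) (≤-reflexive (*-zeroʳ M))) z≤n

-- A chain longer than `(1 - 1/m) t` has at least `t / 2` vertices once `m ≥ 2`.
half-chain : ∀ {m s t} → 2 ≤ m → m * t < m * s + t → t ≤ 2 * s
half-chain {m} {s} {t} 2≤m long = ≮⇒≥ λ lt → <⇒≱ long (cancel {2} z<s (begin
  2 * (m * s + t)           ≡⟨ e₁ m s t ⟩
  m * (2 * s) + 2 * t       ≤⟨ +-monoʳ-≤ (m * (2 * s)) (*-monoˡ-≤ t 2≤m) ⟩
  m * (2 * s) + m * t       ≤⟨ +-monoˡ-≤ (m * t) (*-monoʳ-≤ m (<⇒≤ lt)) ⟩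
  m * t + m * t             ≡⟨ e₂ m t ⟩
  2 * (m * t)               ∎))
  where
  open ≤-Reasoning
  e₁ : ∀ m l t → 2 * (m * l + t) ≡ m * (2 * l) + 2 * t
  e₁ = solve-∀
  e₂ : ∀ m t → m * t + m * t ≡ 2 * (m * t)
  e₂ = solve-∀

blocks : ∀ {n} {T : Digraph n} w N → 0 < w → 2 * w ≡ N → ∀ S → Chain T S → w ≤ length S →
  Σ (Fin w → List (Fin n)) λ B → (∀ j → B j ⊆ S) × (∀ j → length S ≤ N * length (B j)) ×
    (∀ i j → i Fin.< j → ∀ x y → x ∈ B i → y ∈ B j → T x y ≡ true)
blocks w N 0<w refl S ch w≤S with block-size w 1 (length S) 0<w z<s (≤-trans (≤-reflexive (*-identityʳ w)) w≤S)
... | r , _ , wr≤ , S≤ = block r S , block-⊆ r S ,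
  (λ j → subst (λ z → length S ≤ N * z) (sym (block-length r S j wr≤)) S≤) ,
  λ i j lt x y x∈ y∈ → block-related r ch lt x∈ y∈

module _ {h} {H : Digraph h} (Htour : IsTournament H) (0<h : 0 < h) (M N : ℕ) (0<M : 0 < M) (N≡ : 2 * 24 ≡ N) where

  private
    0<N : 0 < N
    0<N = subst (0 <_) N≡ z<s

  Families : ℕ → Set
  Families C = ∀ {n} (T : Digraph n) {t C′ m} → IsTournament T → ¬ Embeds T H →
    C ≤ n → N ≤ t → C ≤ C′ → 2 ≤ m → Critical T t C′ m → Family T M N t C

  familyFrom : ∀ D → DenseParts H (2 * (N * M)) 7 D → Families (2 * D)
  familyFrom D parts {n} T {t} {C′} {m} tour free big N≤t D≤C′ 2≤m critical = record
    { X = R.X ; apart = R.X-apart ; dense = R.X-dense ; mids = B-chain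
    ; unique = λ i → AllPairs-⊆ (⊆-trans (R.Z⊆ i) (proj₁ (P-big (part i)))) (allFin⁺ n)
    ; chain = λ j → AllPairs-⊆ (B⊆ j) S-chain
    ; lin-big = lin-big ; mid-big = mid-big }
    where
    open ≤-Reasoning
    Ps = parts tour free (allFin n) (allFin⁺ n) (≤-trans (≤-trans (m≤m+n D _) big) (≤-reflexive (sym (length-tabulate id))))
    P = proj₁ Ps
    P-big = proj₁ (proj₂ Ps)
    P-rel = proj₂ (proj₂ Ps)
    P≤ : ∀ i → n ≤ D * length (P i)
    P≤ i = subst (_≤ D * length (P i)) (length-tabulate id) (proj₂ (P-big i))
    Ss = Critical.long critical (P (# 3)) (AllPairs-⊆ (proj₁ (P-big (# 3))) (allFin⁺ n))
          (≤-trans (P≤ (# 3)) (*-monoˡ-≤ (length (P (# 3))) (≤-trans (m≤m+n D _) D≤C′)))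
    S = proj₁ Ss
    S-chain = proj₁ (proj₂ Ss)
    t≤2S : t ≤ 2 * length S
    t≤2S = half-chain 2≤m (proj₂ (proj₂ (proj₂ Ss)))
    24≤S : 24 ≤ length S
    24≤S = cancel {2} z<s (≤-trans (≤-reflexive N≡) (≤-trans N≤t t≤2S))
    Bs = blocks 24 N z<s N≡ S S-chain 24≤S
    B = proj₁ Bs
    B⊆ = proj₁ (proj₂ Bs)
    S≤ = proj₁ (proj₂ (proj₂ Bs))
    B-chain = proj₂ (proj₂ (proj₂ Bs))
    module R = Refine tour M N 0<M 0<N P P-rel S (≤-trans (s≤s z≤n) 24≤S) (proj₁ (proj₂ (proj₂ Ss)))
      B B⊆ S≤ B-chain
    lin-big : ∀ i → n ≤ 2 * D * length (R.Z i)
    lin-big i = begin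
      n                          ≤⟨ P≤ (part i) ⟩
      D * length (P (part i))    ≤⟨ *-monoʳ-≤ D (R.Z-half i) ⟩
      D * (2 * length (R.Z i))   ≡⟨ e D (length (R.Z i)) ⟩
      2 * D * length (R.Z i)     ∎
      where
      e : ∀ a b → a * (2 * b) ≡ 2 * a * b
      e = solve-∀
    mid-big : ∀ j → t ≤ 2 * N * length (B j)
    mid-big j = begin
      t                       ≤⟨ t≤2S ⟩
      2 * length S            ≤⟨ *-monoʳ-≤ 2 (S≤ j) ⟩
      2 * (N * length (B j))  ≡⟨ sym (*-assoc 2 N _) ⟩
      2 * N * length (B j)    ∎

  family : Σ ℕ λ C → 0 < C × Families C
  family = fromParts (denseParts Htour 0<h (2 * (N * M)) (*-mono-≤ {1} {2} (s≤s z≤n) (*-mono-≤ 0<N 0<M)) 7)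
    where
    fromParts : (Σ ℕ λ D → 0 < D × DenseParts H (2 * (N * M)) 7 D) → Σ ℕ λ C → 0 < C × Families C
    fromParts (D , 0<D , parts) = 2 * D , ≤-trans 0<D (m≤m+n D _) , familyFrom D parts

-- Embedding stars

isLin isMid : Slot → Bool
isLin (lin _) = true
isLin (mid _) = false
isMid = not ∘ isLin

-- A vertex owned by c ≠ itself is a leaf of the star with centre c; a vertex owned by nothing
-- belongs to the special piece, which is found before the stars.
Valid : ∀ {h} → Digraph h → (Fin h → Slot) → (Fin h → Maybe (Fin h)) → (Slot → Bool) → (Slot → Slot → Bool) → Set
Valid H slot own dom pat =
  (∀ u v → own u ≢ own v → H u v ≡ before (slot u) (slot v)) ×
  (∀ c u → own u ≡ just c → u ≢ c → isLin (slot c) ≡ true × isMid (slot u) ≡ true ×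
    (∀ v → own v ≡ just c → v ≢ c → H u v ≡ before (slot u) (slot v))) ×
  (∀ u → own u ≡ nothing → dom (slot u) ≡ true ×
    (∀ v → own v ≡ nothing → H u v ≡ true → pat (slot u) (slot v) ≡ true))

record Special {n} (T : Digraph n) (X : Slot → List (Fin n)) (dom : Slot → Bool) (pat : Slot → Slot → Bool) : Set where
  field
    at   : Slot → Fin n
    in-X : ∀ a → dom a ≡ true → at a ∈ X a
    arcs : ∀ a b → dom a ≡ true → dom b ≡ true → pat a b ≡ true → T (at a) (at b) ≡ true

module _ {n} {T : Digraph n} (tour : IsTournament T) {t C m} (critical : Critical T t C m) where

  open Critical critical
  open Tournament tour

  -- Otherwise the long chain `l` in `A` and `Y` join to one chain, in the order given by `b`, and
  -- `m * (length l + length Y) ≥ m * length l + t > m * t` contradicts `short`.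
  mixed : ∀ b A Y → Unique A → n ≤ C * length A → Chain T Y → t ≤ m * length Y →
    ¬ (∀ a y → a ∈ A → y ∈ Y → arc T b a y ≡ true)
  mixed b A Y uniq big Y-chain t≤Y complete with long A uniq big
  ... | l , l-chain , l∈ , l-long = <⇒≱ l-long (begin
    m * length l + t             ≤⟨ +-monoʳ-≤ (m * length l) t≤Y ⟩
    m * length l + m * length Y  ≡⟨ sym (*-distribˡ-+ m (length l) (length Y)) ⟩
    m * (length l + length Y)    ≤⟨ *-monoʳ-≤ m (both b complete) ⟩
    m * t                        ∎)
    where
    open ≤-Reasoning
    both : ∀ b → (∀ a y → a ∈ A → y ∈ Y → arc T b a y ≡ true) → length l + length Y ≤ t
    both true c = subst (_≤ t) (length-++ l) (short (l ++ Y)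
      (AllPairs.++⁺ l-chain Y-chain (All.tabulate λ a∈ → All.tabulate λ y∈ → c _ _ (l∈ _ a∈) y∈)))
    both false c = subst (_≤ t) (trans (length-++ Y) (+-comm (length Y) _)) (short (Y ++ l)
      (AllPairs.++⁺ Y-chain l-chain (All.tabulate λ y∈ → All.tabulate λ a∈ → c _ _ (l∈ _ a∈) y∈)))

  -- If there were `n / C` such vertices, they alone would form a linear set that `mixed` excludes.
  fewComplete : ∀ b A Y → Unique A → Chain T Y → t ≤ m * length Y →
    C * cnt (λ a → every (arc T b a) Y) A < n
  fewComplete b A Y uniq Y-chain t≤Y = ≰⇒> λ le → mixed b (filterᵇ p A) Y (AllPairs-⊆ (filterᵇ-⊆ p A) uniq)
      (subst (λ z → n ≤ C * z) (sym (length-filterᵇ p A)) le) Y-chain t≤Y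
      λ a y a∈ y∈ → every-∈ (arc T b a) (proj₂ (∈-filterᵇ⁻ p {xs = A} a∈)) y∈
    where
    p = λ a → every (arc T b a) Y

  -- Without such an arc `A` would be complete to `B`, in particular to a long chain inside `B`.
  backArc : 2 ≤ m → ∀ A B → Unique A → Unique B → n ≤ C * length A → n ≤ C * length B → Apart A B →
    ∃₂ λ a b → a ∈ A × b ∈ B × T b a ≡ true
  backArc 2≤m A B uA uB A-big B-big apart with every (λ a → every (T a) B) A in e
  ... | false with every-¬ _ A e
  ...   | a , a∈ , e′ with every-¬ _ B e′
  ...     | b , b∈ , e″ = a , b , a∈ , b∈ , flip-false (apart a b a∈ b∈) e″
  backArc 2≤m A B uA uB A-big B-big apart | true with long B uB B-big
  ... | l , l-chain , l∈ , l-long = ⊥-elim (mixed true A l uA A-big l-chain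
      (≤-trans (half-chain 2≤m l-long) (*-monoˡ-≤ (length l) 2≤m))
      λ a b a∈ b∈ → every-∈ (T a) (every-∈ (λ a → every (T a) B) e a∈) (l∈ b b∈))

module Embedding {n} {T : Digraph n} (tour : IsTournament T) {K N t C₀ C m} {h} {W} (2W≤K : 2 * W ≤ K) (h<W : h < W)
  (C₀-star : C₀ * 2 * h ≤ C) (m-star : 2 * N * 2 ≤ m) (0<n : 0 < n) (0<t : 0 < t)
  (critical : Critical T t C m) (fam : Family T (h * K) N t C₀)
  {H : Digraph h} (Htour : IsTournament H) {slot : Fin h → Slot} {own : Fin h → Maybe (Fin h)} {dom pat}
  (valid : Valid H slot own dom pat) where

  open Family fam
  open Tournament tour
  open ≤-Reasoning
  private module HT = Tournament Htour

  0<K : 0 < K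
  0<K = ≤-trans (≤-trans (s≤s z≤n) h<W) (≤-trans (m≤m+n W _) 2W≤K)

  0<h : Fin h → 0 < h
  0<h u = ≤-trans (s≤s z≤n) (Finₚ.toℕ<n u)

  Candidates : Set
  Candidates = Fin h → List (Fin n)

  -- At most a fraction k/K of the family has been discarded.
  State : ℕ → Candidates → Set
  State k Y = ∀ u → Y u ⊆ X (slot u) × K * length (X (slot u)) ≤ K * length (Y u) + k * length (X (slot u))

  Solution : (Fin h → Bool) → Candidates → Set
  Solution q Y = Σ (Fin h → Fin n) λ f → (∀ u → q u ≡ true → f u ∈ Y u) ×
    (∀ u v → q u ≡ true → q v ≡ true → H u v ≡ true → T (f u) (f v) ≡ true)

  -- Every piece costs a candidate set at most a share `1 / K` of its slot, and at most `W ≤ K / 2`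
  -- pieces are placed.
  half : ∀ {k Y} → k ≤ W → State k Y → ∀ u → length (X (slot u)) ≤ 2 * length (Y u)
  half {k} {Y} k≤W st u = cancel 0<K (+-cancelˡ-≤ (K * x) _ _ (begin
    K * x + K * x              ≡⟨ e₁ (K * x) ⟩
    2 * (K * x)                ≤⟨ *-monoʳ-≤ 2 (proj₂ (st u)) ⟩
    2 * (K * y + k * x)        ≤⟨ *-monoʳ-≤ 2 (+-monoʳ-≤ (K * y) (*-monoˡ-≤ x k≤W)) ⟩
    2 * (K * y + W * x)        ≡⟨ e₂ K W x y ⟩
    2 * W * x + K * (2 * y)    ≤⟨ +-monoˡ-≤ (K * (2 * y)) (*-monoˡ-≤ x 2W≤K) ⟩
    K * x + K * (2 * y)        ∎))
    where
    x = length (X (slot u))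
    y = length (Y u)
    e₁ : ∀ a → a + a ≡ 2 * a
    e₁ = solve-∀
    e₂ : ∀ k w x y → 2 * (k * y + w * x) ≡ 2 * w * x + k * (2 * y)
    e₂ = solve-∀

  -- Vertices in different pieces are joined in `H` as the order of their slots says; the two halves
  -- of `Dense` serve the two possible orders.
  good : ∀ u v → own u ≢ own v → ∀ x → x ∈ X (slot v) →
    h * K * cnt (not ∘ arc T (H v u) x) (X (slot u)) ≤ length (X (slot u))
  good u v ne x x∈ with H v u in e
  ... | true = proj₁ (dense (slot v) (slot u) (trans (sym (proj₁ valid v u (ne ∘ sym))) e)) x x∈
  ... | false = proj₂ (dense (slot u) (slot v) (trans (sym (proj₁ valid u v ne)) (HT.flip-false (λ { refl → ne refl }) e))) x x∈

  -- A piece has at most `h` vertices, each spoiling a share of at most `1 / (h * K)` of every slot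
  -- outside the piece, so the restriction costs `1 / K` in total. The rest of the embedding is a
  -- continuation because it has to start from the restricted sets.
  addPiece : ∀ {k Y} → State k Y → ∀ (p q : Fin h → Bool) (f : Fin h → Fin n) →
    (∀ u → p u ≡ true → f u ∈ Y u) →
    (∀ u v → p u ≡ true → p v ≡ true → H u v ≡ true → T (f u) (f v) ≡ true) →
    (∀ u v → p u ≡ false → p v ≡ true → own u ≢ own v) →
    (∀ Y′ → State (suc k) Y′ → Solution q Y′) → Solution (λ u → p u ∨ q u) Y
  addPiece {k} {Y} st p q f f∈ f-arcs cross rest = merge (rest Y′ st′)
    where
    -- Only a vertex `u` outside the piece is restricted by a vertex `v` in it; arcs inside the
    -- piece are supplied by `f-arcs`.
    ok : Fin h → Fin h → Fin n → Bool
    ok u v w = if p v ∧ not (p u) then arc T (H v u) (f v) w else true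
    Y′ : Candidates
    Y′ u = filterᵇ (λ w → every (λ v → ok u v w) (allFin h)) (Y u)
    Y′⊆ : ∀ u → Y′ u ⊆ Y u
    Y′⊆ u = filterᵇ-⊆ _ (Y u)
    lost : ∀ u v → h * K * cnt (λ w → not (ok u v w)) (Y u) ≤ length (X (slot u))
    lost u v with p v in pv | p u in pu
    ... | true | false = begin
      h * K * cnt (not ∘ arc T (H v u) (f v)) (Y u)           ≤⟨ *-monoʳ-≤ (h * K) (cnt-⊆ _ (proj₁ (st u))) ⟩
      h * K * cnt (not ∘ arc T (H v u) (f v)) (X (slot u))    ≤⟨ good u v (cross u v pu pv) (f v) (⊆-lookup (proj₁ (st v)) (f∈ v pv)) ⟩
      length (X (slot u))                                     ∎
    ... | true | true = ≤-trans (≤-reflexive (trans (cong (h * K *_) (∑-zero (Y u))) (*-zeroʳ (h * K)))) z≤n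
    ... | false | _ = ≤-trans (≤-reflexive (trans (cong (h * K *_) (∑-zero (Y u))) (*-zeroʳ (h * K)))) z≤n
    lost-all : ∀ u → K * ∑ (allFin h) (λ v → cnt (λ w → not (ok u v w)) (Y u)) ≤ length (X (slot u))
    lost-all u = cancel {h} (0<h u) (begin
      h * (K * S)                                                                  ≡⟨ sym (*-assoc h K S) ⟩
      h * K * S                                                                    ≡⟨ sym (∑-* (h * K) (allFin h) (λ v → cnt (λ w → not (ok u v w)) (Y u))) ⟩
      ∑ (allFin h) (λ v → h * K * cnt (λ w → not (ok u v w)) (Y u))                ≤⟨ ∑-≤-const (allFin h) (length (X (slot u))) (λ v _ → lost u v) ⟩
      length (allFin h) * length (X (slot u))                                      ≡⟨ cong (_* length (X (slot u))) (length-tabulate {n = h} id) ⟩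
      h * length (X (slot u))                                                      ∎)
      where
      S = ∑ (allFin h) (λ v → cnt (λ w → not (ok u v w)) (Y u))
    st′ : State (suc k) Y′
    st′ u = ⊆-trans (Y′⊆ u) (proj₁ (st u)) , (begin
      K * x                           ≤⟨ proj₂ (st u) ⟩
      K * length (Y u) + k * x        ≤⟨ +-monoˡ-≤ (k * x) (*-monoʳ-≤ K (cnt-every (λ v w → ok u v w) (allFin h) (Y u))) ⟩
      K * (cnt E (Y u) + S) + k * x   ≡⟨ cong (λ z → K * (z + S) + k * x) (sym (length-filterᵇ E (Y u))) ⟩
      K * (length (Y′ u) + S) + k * x ≡⟨ cong (_+ k * x) (*-distribˡ-+ K (length (Y′ u)) S) ⟩
      K * length (Y′ u) + K * S + k * x   ≤⟨ +-monoˡ-≤ (k * x) (+-monoʳ-≤ (K * length (Y′ u)) (lost-all u)) ⟩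
      K * length (Y′ u) + x + k * x   ≡⟨ +-assoc (K * length (Y′ u)) x (k * x) ⟩
      K * length (Y′ u) + suc k * x   ∎)
      where
      x = length (X (slot u))
      E = λ w → every (λ v → ok u v w) (allFin h)
      S = ∑ (allFin h) (λ v → cnt (λ w → not (ok u v w)) (Y u))
    merge : Solution q Y′ → Solution (λ u → p u ∨ q u) Y
    merge (f′ , f′∈ , f′-arcs) = g , g∈ , g-arcs
      where
      g : Fin h → Fin n
      g u = if p u then f u else f′ u
      g∈ : ∀ u → p u ∨ q u ≡ true → g u ∈ Y u
      g∈ u e with p u in pu
      ... | true = f∈ u pu
      ... | false = ⊆-lookup (Y′⊆ u) (f′∈ u e)
      consistent : ∀ u v → p u ≡ false → p v ≡ true → q u ≡ true → arc T (H v u) (f v) (f′ u) ≡ true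
      consistent u v pu pv qu = subst₂ (λ a b → (if a ∧ not b then arc T (H v u) (f v) (f′ u) else true) ≡ true) pv pu
        (every-∈ (λ v → ok u v (f′ u)) (proj₂ (∈-filterᵇ⁻ (λ w → every (λ v → ok u v w) (allFin h)) {xs = Y u} (f′∈ u qu))) (∈-allFin v))
      g-arcs : ∀ u v → p u ∨ q u ≡ true → p v ∨ q v ≡ true → H u v ≡ true → T (g u) (g v) ≡ true
      g-arcs u v qu qv e with p u in pu | p v in pv
      ... | true | true = f-arcs u v pu pv e
      ... | true | false = subst (λ b → arc T b (f u) (f′ v) ≡ true) e (consistent v u pv pu qv)
      ... | false | true = subst (λ b → arc T b (f v) (f′ u) ≡ true) (HT.flip-true e) (consistent u v pu pv qu)
      ... | false | false = f′-arcs u v qu qv e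

  lin-nonempty : ∀ {k Y} → k ≤ W → State k Y → ∀ u → 0 < length (Y u)
  lin-nonempty {k} {Y} k≤W st u with length (Y u) | half k≤W st u
  ... | suc _ | _ = z<s
  ... | zero | le = ⊥-elim (empty (slot u) (n≤0⇒n≡0 le))
    where
    empty : ∀ a → length (X a) ≢ 0
    empty (lin i) e = <⇒≱ 0<n (≤-trans (lin-big i) (≤-reflexive (trans (cong (C₀ *_) e) (*-zeroʳ C₀))))
    empty (mid j) e = <⇒≱ 0<t (≤-trans (mid-big j) (≤-reflexive (trans (cong (2 * N *_) e) (*-zeroʳ (2 * N)))))

  _owns_ : Fin h → Fin h → Bool
  c owns u = does (≡-dec Finₚ._≟_ (own u) (just c))

  owns-true : ∀ {c u} → c owns u ≡ true → own u ≡ just c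
  owns-true {c} {u} e with ≡-dec Finₚ._≟_ (own u) (just c)
  ... | yes eq = eq

  owns-false : ∀ {c u} → c owns u ≡ false → own u ≢ just c
  owns-false {c} {u} e with ≡-dec Finₚ._≟_ (own u) (just c)
  ... | no ne = ne

  Leaf : Fin h → Fin h → Set
  Leaf c u = own u ≡ just c × u ≢ c

  Leaf? : ∀ c u → Dec (Leaf c u)
  Leaf? c u with ≡-dec Finₚ._≟_ (own u) (just c) | u Finₚ.≟ c
  ... | yes o | no ne = yes (o , ne)
  ... | yes o | yes e = no λ l → proj₂ l e
  ... | no ¬o | _ = no (¬o ∘ proj₁)

  -- For each leaf `u`, fewer than `n / C` vertices are joined to all of `Y u` in the wrong
  -- direction, which is less than an `h`-th of `Y c`; hence one centre serves all its leaves. A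
  -- vertex placed in an interval has no leaves by validity, and any candidate will do.
  starPiece : ∀ {k Y} → k ≤ W → State k Y → ∀ c → ∃ λ w → w ∈ Y c ×
    (∀ u → Leaf c u → ∃ λ s → s ∈ Y u × arc T (H c u) w s ≡ true)
  starPiece {k} {Y} k≤W st c with slot c in eq
  ... | mid _ with nonempty (lin-nonempty k≤W st c)
  ...   | w , w∈ = w , w∈ , λ u l → ⊥-elim (true≢false (trans (sym (proj₁ (proj₁ (proj₂ valid) c u (proj₁ l) (proj₂ l)))) (cong isLin eq)))
  starPiece {k} {Y} k≤W st c | lin i with avoid ok (Y c) (lin-nonempty k≤W st c) few
    where
    ok : Fin h → Fin n → Bool
    ok u w = not (does (Leaf? c u) ∧ every (λ s → not (arc T (H c u) w s)) (Y u))
    few : ∀ u → h * cnt (not ∘ ok u) (Y c) < length (Y c)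
    few u with Leaf? c u
    ... | no _ = subst (_< length (Y c)) (sym (trans (cong (h *_) (∑-zero (Y c))) (*-zeroʳ h))) (lin-nonempty k≤W st c)
    ... | yes l = cancel-< (C₀ * 2) (begin-strict
      C₀ * 2 * (h * cnt bad (Y c))  ≡⟨ sym (*-assoc (C₀ * 2) h _) ⟩
      C₀ * 2 * h * cnt bad (Y c)    ≤⟨ *-monoˡ-≤ (cnt bad (Y c)) C₀-star ⟩
      C * cnt bad (Y c)             ≤⟨ *-monoʳ-≤ C (cnt-mono (Y c) λ w w∈ e → every-mono (Y u) (λ s s∈ → not-arc (H c u) (apart-cu w s w∈ s∈)) (not-not e)) ⟩
      C * cnt (λ w → every (arc T (not (H c u)) w) (Y u)) (Y c) <⟨ fewComplete tour critical (not (H c u)) (Y c) (Y u) Yc-unique Yu-chain t≤Yu ⟩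
      n                             ≤⟨ lin-big i ⟩
      C₀ * length (X (lin i))       ≡⟨ cong (λ a → C₀ * length (X a)) (sym eq) ⟩
      C₀ * length (X (slot c))      ≤⟨ *-monoʳ-≤ C₀ (half k≤W st c) ⟩
      C₀ * (2 * length (Y c))       ≡⟨ sym (*-assoc C₀ 2 _) ⟩
      C₀ * 2 * length (Y c)         ∎)
      where
      bad = λ w → not (not (every (λ s → not (arc T (H c u) w s)) (Y u)))
      not-not : ∀ {b} → not (not b) ≡ true → b ≡ true
      not-not {true} _ = refl
      u-mid : isMid (slot u) ≡ true
      u-mid = proj₁ (proj₂ (proj₁ (proj₂ valid) c u (proj₁ l) (proj₂ l)))
      apart-cu : ∀ w s → w ∈ Y c → s ∈ Y u → w ≢ s
      apart-cu w s w∈ s∈ = apart (slot c) (slot u) (λ e → true≢false (trans (sym u-mid) (cong isMid (trans (sym e) eq)))) w s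
        (⊆-lookup (proj₁ (st c)) w∈) (⊆-lookup (proj₁ (st u)) s∈)
      every-mono : ∀ {p q : Fin n → Bool} ys → (∀ s → s ∈ ys → p s ≡ false → q s ≡ true) → every (λ s → not (p s)) ys ≡ true → every q ys ≡ true
      every-mono [] h e = refl
      every-mono {p} (y ∷ ys) h e with p y in py
      ... | false rewrite h y (here refl) py = every-mono ys (λ s s∈ → h s (there s∈)) e
      Yc-unique : Unique (Y c)
      Yc-unique = AllPairs-⊆ (subst (λ a → Y c ⊆ X a) eq (proj₁ (st c))) (unique i)
      mid-chain : ∀ a → isMid a ≡ true → Chain T (X a) × t ≤ 2 * N * length (X a)
      mid-chain (mid j) _ = chain j , mid-big j
      Yu-chain : Chain T (Y u)
      Yu-chain = AllPairs-⊆ (proj₁ (st u)) (proj₁ (mid-chain (slot u) u-mid))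
      t≤Yu : t ≤ m * length (Y u)
      t≤Yu = begin
        t                               ≤⟨ proj₂ (mid-chain (slot u) u-mid) ⟩
        2 * N * length (X (slot u))     ≤⟨ *-monoʳ-≤ (2 * N) (half k≤W st u) ⟩
        2 * N * (2 * length (Y u))      ≡⟨ sym (*-assoc (2 * N) 2 _) ⟩
        2 * N * 2 * length (Y u)        ≤⟨ *-monoˡ-≤ (length (Y u)) m-star ⟩
        m * length (Y u)                ∎
  ... | w , w∈ , w-ok = w , w∈ , leaf
    where
    leaf : ∀ u → Leaf c u → ∃ λ s → s ∈ Y u × arc T (H c u) w s ≡ true
    leaf u l with Leaf? c u | w-ok u
    ... | no ¬l | _ = ⊥-elim (¬l l)
    ... | yes _ | e with every (λ s → not (arc T (H c u) w s)) (Y u) in ev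
    ...   | false with every-¬ _ (Y u) ev
    ...     | s , s∈ , e′ = s , s∈ , not-false e′

  ownedBy : List (Fin h) → Fin h → Bool
  ownedBy [] u = false
  ownedBy (c ∷ cs) u = c owns u ∨ ownedBy cs u

  mid-arc : ∀ a b → isMid a ≡ true → isMid b ≡ true → before a b ≡ true → ∀ x y → x ∈ X a → y ∈ X b → T x y ≡ true
  mid-arc (mid i) (mid j) _ _ e = mids i j (≤ᵇ-true e)

  -- Every vertex of `H` takes its turn as a centre; the piece of one that owns nothing is empty but
  -- still counts towards the budget `W`.
  stars : ∀ cs k Y → k + length cs ≤ W → State k Y → Solution (ownedBy cs) Y
  stars [] k Y le st = (λ u → proj₁ (nonempty {xs = Y u} (lin-nonempty {k} {Y} (≤-trans (m≤m+n k 0) le) st u))) , (λ _ ()) , λ _ _ ()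
  stars (c ∷ cs) k Y le st with starPiece {k} {Y} (≤-trans (m≤m+n k _) le) st c
  ... | w , w∈ , leaf = addPiece {k} {Y} st (c owns_) (ownedBy cs) f f∈ f-arcs
          (λ u v pu pv e → owns-false pu (trans e (owns-true pv)))
          (λ Y′ → stars cs (suc k) Y′ (≤-trans (≤-reflexive (sym (+-suc k (length cs)))) le))
    where
    f : Fin h → Fin n
    f u with Leaf? c u
    ... | yes l = proj₁ (leaf u l)
    ... | no _ = w
    centre : ∀ u → own u ≡ just c → ¬ Leaf c u → u ≡ c
    centre u o ¬l with u Finₚ.≟ c
    ... | yes e = e
    ... | no ne = ⊥-elim (¬l (o , ne))
    f∈ : ∀ u → c owns u ≡ true → f u ∈ Y u
    f∈ u o with Leaf? c u
    ... | yes l = proj₁ (proj₂ (leaf u l))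
    ... | no ¬l = subst (λ v → w ∈ Y v) (sym (centre u (owns-true o) ¬l)) w∈
    f-arcs : ∀ u v → c owns u ≡ true → c owns v ≡ true → H u v ≡ true → T (f u) (f v) ≡ true
    f-arcs u v ou ov e with Leaf? c u | Leaf? c v
    -- Two leaves of one star lie in intervals of the same chain, so the arc between them is forward
    -- however they were chosen.
    ... | yes l | yes l′ = mid-arc (slot u) (slot v) (proj₁ (proj₂ lu)) (proj₁ (proj₂ lv))
            (trans (sym (proj₂ (proj₂ lu) v (proj₁ l′) (proj₂ l′))) e) _ _
            (⊆-lookup (proj₁ (st u)) (proj₁ (proj₂ (leaf u l)))) (⊆-lookup (proj₁ (st v)) (proj₁ (proj₂ (leaf v l′))))
      where
      lu = proj₁ (proj₂ valid) c u (proj₁ l) (proj₂ l)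
      lv = proj₁ (proj₂ valid) c v (proj₁ l′) (proj₂ l′)
    ... | yes l | no ¬l′ with refl ← centre v (owns-true ov) ¬l′ =
      subst (λ b → arc T b w (proj₁ (leaf u l)) ≡ true) (HT.flip-true e) (proj₂ (proj₂ (leaf u l)))
    ... | no ¬l | yes l′ with refl ← centre u (owns-true ou) ¬l =
      subst (λ b → arc T b w (proj₁ (leaf v l′)) ≡ true) e (proj₂ (proj₂ (leaf v l′)))
    ... | no ¬l | no ¬l′ = ⊥-elim (HT.arc⇒≢ e (trans (centre u (owns-true ou) ¬l) (sym (centre v (owns-true ov) ¬l′))))

  -- The special piece comes first: its vertices are given in advance and need not survive in
  -- candidate sets already restricted by stars. This makes `1 + h ≤ W` pieces.
  embedding : Special T X dom pat → Embeds T H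
  embedding sp = f , λ {u} {v} → f-arcs u v (covered u) (covered v)
    where
    open Special sp renaming (arcs to sp-arcs)
    special : Fin h → Bool
    special u = does (≡-dec Finₚ._≟_ (own u) nothing)
    special-true : ∀ u → special u ≡ true → own u ≡ nothing
    special-true u e with ≡-dec Finₚ._≟_ (own u) nothing
    ... | yes eq = eq
    special-false : ∀ u → special u ≡ false → own u ≢ nothing
    special-false u e with ≡-dec Finₚ._≟_ (own u) nothing
    ... | no ne = ne
    Y : Candidates
    Y u = X (slot u)
    sol = addPiece {0} {Y} (λ u → ⊆-refl , ≤-reflexive (sym (+-identityʳ _))) special (ownedBy (allFin h)) (at ∘ slot)
      (λ u su → in-X (slot u) (proj₁ (proj₂ (proj₂ valid) u (special-true u su))))
      (λ u v su sv e → sp-arcs (slot u) (slot v)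
        (proj₁ (proj₂ (proj₂ valid) u (special-true u su))) (proj₁ (proj₂ (proj₂ valid) v (special-true v sv)))
        (proj₂ (proj₂ (proj₂ valid) u (special-true u su)) v (special-true v sv) e))
      (λ u v su sv e → special-false u su (trans e (special-true v sv)))
      (λ Y′ → stars (allFin h) 1 Y′ (subst (λ l → suc l ≤ W) (sym (length-tabulate {n = h} id)) h<W))
    f = proj₁ sol
    f-arcs = proj₂ (proj₂ sol)
    owned : ∀ {c u} cs → c ∈ cs → own u ≡ just c → ownedBy cs u ≡ true
    owned {u = u} (c ∷ cs) (here refl) o rewrite dec-true (≡-dec Finₚ._≟_ (own u) (just c)) o = refl
    owned {u = u} (c ∷ cs) (there c∈) o with c owns u
    ... | true = refl
    ... | false = owned cs c∈ o
    covered : ∀ u → special u ∨ ownedBy (allFin h) u ≡ true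
    covered u with own u in o
    ... | nothing = refl
    ... | just c = owned (allFin h) (∈-allFin c) o

-- Two typical vertices joined by a backward arc

even : ℕ → Bool
even zero = true
even (suc n) = not (even n)

-- Of the three linear slots on each side the middle one is taken, so that linear slots remain
-- before and after both ends.
pattern left = lin (suc zero)
pattern right = lin (suc (suc (suc (suc zero))))

isEnd : Slot → Bool
isEnd left = true
isEnd right = true
isEnd _ = false

-- Six intervals stay free on either side. They hold the other vertices placed in intervals when a
-- triangle occurs, since its interval may be any central one.
central : Fin 24 → Bool
central j = (6 ≤ᵇ toℕ j) ∧ (toℕ j <ᵇ 18)

cleanDom : Slot → Bool
cleanDom (mid j) = central j
cleanDom a = isEnd a

-- A backward arc from right to left; the even slots hold leaves of right, the odd ones leaves of left.
cleanPat : Slot → Slot → Bool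
cleanPat right left = true
cleanPat (lin _) (mid j) = even (toℕ j)
cleanPat (mid j) (lin _) = not (even (toℕ j))
cleanPat (mid i) (mid j) = toℕ i <ᵇ toℕ j
cleanPat _ _ = false

triangleDom : Fin 24 → Slot → Bool
triangleDom j (mid k) = toℕ j ≡ᵇ toℕ k
triangleDom j a = isEnd a

-- The three arcs are all backward in the order left, interval, right; the triple is transitive, not
-- a directed cycle.
trianglePat : Slot → Slot → Bool
trianglePat right left = true
trianglePat right (mid _) = true
trianglePat (mid _) left = true
trianglePat _ _ = false

module _ {n} {T : Digraph n} (tour : IsTournament T) {t C m} (critical : Critical T t C m) where

  open Tournament tour

  -- Each interval spoils fewer than `n / C` vertices of `A`, all of them together at most
  -- `w * n / C`, which is at most half of `A`. What remains is still large enough for `backArc`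
  -- with the same `C`.
  typical : ∀ {w C₀} → 2 * w * C₀ ≤ C → 0 < w → (B : Fin w → List (Fin n)) → (∀ j → Chain T (B j)) → (∀ j → t ≤ m * length (B j)) →
    ∀ b (sel : Fin w → Bool) A → Unique A → n ≤ C₀ * length A → (∀ j → Apart A (B j)) →
    Σ (List (Fin n)) λ Z → Z ⊆ A × n ≤ C * length Z ×
      (∀ z → z ∈ Z → ∀ j → sel j ≡ true → ∃ λ s → s ∈ B j × arc T b z s ≡ true)
  typical {w} {C₀} C-big 0<w B B-chain B-big b sel A uniq A-big apart = Z , filterᵇ-⊆ E A , Z-big , leaf
    where
    open ≤-Reasoning
    ok : Fin w → Fin n → Bool
    ok j z = not (sel j ∧ every (arc T (not b) z) (B j))
    E : Fin n → Bool
    E z = every (λ j → ok j z) (allFin w)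
    Z = filterᵇ E A
    a = length A
    bad≤ : ∀ a {e} → not (not (a ∧ e)) ≡ true → e ≡ true
    bad≤ true {true} _ = refl
    few : ∀ j → C * cnt (not ∘ ok j) A ≤ n
    few j = <⇒≤ (≤-<-trans (*-monoʳ-≤ C (cnt-mono A (λ z _ → bad≤ (sel j)))) (fewComplete tour critical (not b) A (B j) uniq (B-chain j) (B-big j)))
    S = ∑ (allFin w) (λ j → cnt (not ∘ ok j) A)
    CS≤ : C * S ≤ w * n
    CS≤ = begin
      C * S                                            ≡⟨ sym (∑-* C (allFin w) (λ j → cnt (not ∘ ok j) A)) ⟩
      ∑ (allFin w) (λ j → C * cnt (not ∘ ok j) A)      ≤⟨ ∑-≤-const (allFin w) n (λ j _ → few j) ⟩
      length (allFin w) * n                            ≡⟨ cong (_* n) (length-tabulate {n = w} id) ⟩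
      w * n                                            ∎
    Z-big : n ≤ C * length Z
    Z-big = ≤-trans (cancel 0<w (+-cancelʳ-≤ (w * n) _ _ (begin
      w * n + w * n           ≡⟨ e₁ w n ⟩
      2 * w * n               ≤⟨ *-monoʳ-≤ (2 * w) A-big ⟩
      2 * w * (C₀ * a)        ≡⟨ sym (*-assoc (2 * w) C₀ a) ⟩
      2 * w * C₀ * a          ≤⟨ *-monoˡ-≤ a C-big ⟩
      C * a                   ≤⟨ *-monoʳ-≤ C (cnt-every ok (allFin w) A) ⟩
      C * (cnt E A + S)       ≡⟨ *-distribˡ-+ C (cnt E A) S ⟩
      C * cnt E A + C * S     ≤⟨ +-mono-≤ (≤-trans (≤-reflexive (cong (C *_) (sym (length-filterᵇ E A)))) (m≤n*m (C * length Z) w {{>-nonZero 0<w}})) CS≤ ⟩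
      w * (C * length Z) + w * n ∎))) ≤-refl
      where
      e₁ : ∀ w n → w * n + w * n ≡ 2 * w * n
      e₁ = solve-∀
    leaf : ∀ z → z ∈ Z → ∀ j → sel j ≡ true → ∃ λ s → s ∈ B j × arc T b z s ≡ true
    leaf z z∈ j sj = go (every-¬ (arc T (not b) z) (B j) (missing sj (every-∈ (λ j → ok j z) (proj₂ z∈′) (∈-allFin j))))
      where
      z∈′ = ∈-filterᵇ⁻ E {xs = A} z∈
      missing : ∀ {a e} → a ≡ true → not (a ∧ e) ≡ true → e ≡ false
      missing {e = false} refl _ = refl
      go : (∃ λ s → s ∈ B j × arc T (not b) z s ≡ false) → ∃ λ s → s ∈ B j × arc T b z s ≡ true
      go (s , s∈ , e′) = s , s∈ , subst (λ b → arc T b z s ≡ true) (not-involutive b) (not-arc (not b) (apart j z s (proj₁ z∈′) s∈) e′)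

module _ {n} {T : Digraph n} (tour : IsTournament T) {M N t C₀ C m} (2≤m : 2 ≤ m) (2N≤m : 2 * N ≤ m) (C₀-pair : 2 * 24 * C₀ ≤ C)
  (critical : Critical T t C m) (fam : Family T M N t C₀) where

  open Family fam
  open Tournament tour

  PairPiece : Set
  PairPiece = Special T X cleanDom cleanPat ⊎ (∃ λ j → central j ≡ true × Special T X (triangleDom j) trianglePat)

  pairPiece : PairPiece
  pairPiece = choose (backArc tour critical 2≤m (proj₁ XL) (proj₁ XR)
      (AllPairs-⊆ (proj₁ (proj₂ XL)) (unique _)) (AllPairs-⊆ (proj₁ (proj₂ XR)) (unique _))
      (proj₁ (proj₂ (proj₂ XL))) (proj₁ (proj₂ (proj₂ XR)))
      λ a b a∈ b∈ → apart left right (λ ()) a b (⊆-lookup (proj₁ (proj₂ XL)) a∈) (⊆-lookup (proj₁ (proj₂ XR)) b∈))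
    where
    ends : ∀ i b sel → Σ (List (Fin n)) λ Z → Z ⊆ X (lin i) × n ≤ C * length Z ×
      (∀ z → z ∈ Z → ∀ j → sel j ≡ true → ∃ λ s → s ∈ X (mid j) × arc T b z s ≡ true)
    ends i b sel = typical tour critical {24} {C₀} C₀-pair z<s (X ∘ mid) chain (λ j → ≤-trans (mid-big j) (*-monoˡ-≤ (length (X (mid j))) 2N≤m))
      b sel (X (lin i)) (unique i) (lin-big i) (λ j → apart (lin i) (mid j) λ ())
    -- Backward arcs at the left end come in from the intervals (`false`), those at the right end go
    -- out to them (`true`); parity decides which end an interval serves.
    XL = ends (# 1) false (not ∘ even ∘ toℕ)
    XR = ends (# 4) true (even ∘ toℕ)
    choose : (∃₂ λ x y → x ∈ proj₁ XL × y ∈ proj₁ XR × T y x ≡ true) → PairPiece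
    -- Each leaf is joined backwards to one end by choice. If some central leaf is joined backwards
    -- to the other end too, it gives a triangle; otherwise all central leaves are forward to the
    -- other end.
    choose (x , y , x∈ , y∈ , yx) = decide (Finₚ.any? (λ j → (central j ≟ᵇ true) ×-dec (T y (leaf j) ≟ᵇ true) ×-dec (T (leaf j) x ≟ᵇ true)))
      where
      x∈X : x ∈ X left
      x∈X = ⊆-lookup (proj₁ (proj₂ XL)) x∈
      y∈X : y ∈ X right
      y∈X = ⊆-lookup (proj₁ (proj₂ XR)) y∈
      Leaf-at : Fin 24 → Fin n → Set
      Leaf-at j s = s ∈ X (mid j) × (even (toℕ j) ≡ true → T y s ≡ true) × (even (toℕ j) ≡ false → T s x ≡ true)
      leaves : ∀ j → ∃ (Leaf-at j)
      leaves j with even (toℕ j) in e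
      ... | true with proj₂ (proj₂ (proj₂ XR)) y y∈ j e
      ...   | s , s∈ , ys = s , s∈ , (λ _ → ys) , λ ()
      leaves j | false with proj₂ (proj₂ (proj₂ XL)) x x∈ j (cong not e)
      ...   | s , s∈ , sx = s , s∈ , (λ ()) , λ _ → sx
      leaf : Fin 24 → Fin n
      leaf j = proj₁ (leaves j)
      leaf∈ : ∀ j → leaf j ∈ X (mid j)
      leaf∈ j = proj₁ (proj₂ (leaves j))
      at : Slot → Fin n
      at left = x
      at right = y
      -- An arbitrary value: the remaining linear slots lie outside both domains.
      at (lin _) = x
      at (mid j) = leaf j
      end∈ : ∀ i → isEnd (lin i) ≡ true → at (lin i) ∈ X (lin i)
      end∈ (suc zero) _ = x∈X
      end∈ (suc (suc (suc (suc zero)))) _ = y∈X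
      decide : Dec (∃ λ j → central j ≡ true × T y (leaf j) ≡ true × T (leaf j) x ≡ true) → PairPiece
      decide (yes (j , cj , ys , sx)) = inj₂ (j , cj , record { at = at ; in-X = in-X ; arcs = arcs })
        where
        at-j : ∀ k → (toℕ j ≡ᵇ toℕ k) ≡ true → k ≡ j
        at-j k e = sym (Finₚ.toℕ-injective (≡ᵇ⇒≡ (toℕ j) (toℕ k) (subst T′ (sym e) _)))
        in-X : ∀ a → triangleDom j a ≡ true → at a ∈ X a
        in-X (lin i) e = end∈ i e
        in-X (mid k) _ = leaf∈ k
        arcs : ∀ a b → triangleDom j a ≡ true → triangleDom j b ≡ true → trianglePat a b ≡ true → T (at a) (at b) ≡ true
        arcs right left _ _ _ = yx
        arcs right (mid k) _ e _ rewrite at-j k e = ys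
        arcs (mid k) left e _ _ rewrite at-j k e = sx
      decide (no none) = inj₁ (record { at = at ; in-X = in-X ; arcs = arcs })
        where
        in-X : ∀ a → cleanDom a ≡ true → at a ∈ X a
        in-X (lin i) e = end∈ i e
        in-X (mid k) _ = leaf∈ k
        x≢ : ∀ j → x ≢ leaf j
        x≢ j = apart left (mid j) (λ ()) x (leaf j) x∈X (leaf∈ j)
        y≢ : ∀ j → y ≢ leaf j
        y≢ j = apart right (mid j) (λ ()) y (leaf j) y∈X (leaf∈ j)
        clean : ∀ j → central j ≡ true →
          (even (toℕ j) ≡ true → T y (leaf j) ≡ true × T x (leaf j) ≡ true) ×
          (even (toℕ j) ≡ false → T (leaf j) y ≡ true × T (leaf j) x ≡ true)
        clean j cj = (λ e → ys e , xs (ys e)) , (λ e → sy (sx e) , sx e)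
          where
          ys = proj₁ (proj₂ (proj₂ (leaves j)))
          sx = proj₂ (proj₂ (proj₂ (leaves j)))
          xs : T y (leaf j) ≡ true → T x (leaf j) ≡ true
          xs e with T (leaf j) x in sx
          ... | true = ⊥-elim (none (j , cj , e , sx))
          ... | false = flip-false (x≢ j ∘ sym) sx
          sy : T (leaf j) x ≡ true → T (leaf j) y ≡ true
          sy e with T y (leaf j) in ys
          ... | true = ⊥-elim (none (j , cj , ys , e))
          ... | false = flip-false (y≢ j) ys
        not-true : ∀ {b} → not b ≡ true → b ≡ false
        not-true {false} _ = refl
        arcs : ∀ a b → cleanDom a ≡ true → cleanDom b ≡ true → cleanPat a b ≡ true → T (at a) (at b) ≡ true
        arcs right left _ _ _ = yx
        arcs right (mid k) _ ck e = proj₁ (proj₁ (clean k ck) e)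
        arcs left (mid k) _ ck e = proj₂ (proj₁ (clean k ck) e)
        arcs (mid k) right ck _ e = proj₁ (proj₂ (clean k ck) (not-true e))
        arcs (mid k) left ck _ e = proj₂ (proj₂ (clean k ck) (not-true e))
        arcs (mid i) (mid j) _ _ e = mids i j (≤ᵇ-true e) _ _ (leaf∈ i) (leaf∈ j)

-- Induction on the number of vertices

-- H is unavoidable either by stars alone, or by a pair of stars joined by a backward arc
-- together with, in the other outcome of pairPiece, a triangle.
data Plan (H : Digraph 6) : Set where
  stars-only : ∀ slot own → Valid H slot own (λ _ → false) (λ _ _ → false) → Plan H
  pair-or-triangle : ∀ slot own (slot′ : Fin 24 → Fin 6 → Slot) own′ → Valid H slot own cleanDom cleanPat →
    (∀ j → central j ≡ true → Valid H (slot′ j) own′ (triangleDom j) trianglePat) → Plan H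

-- The parameter is `suc m` because the induction on `n` plays the ratio `(m + 1) / m` against the
-- loss of a constant factor in size.
Forced : ∀ {h} → Digraph h → ℕ → ℕ → ℕ → Set
Forced H K C m = ∀ {n} (T : Digraph n) t → IsTournament T → ¬ Embeds T H → C ≤ n → K ≤ t → ¬ Critical T t C (suc m)

module _ {H : Digraph 6} (Htour : IsTournament H) (plan : Plan H) {W K N} (2W≤K : 2 * W ≤ K) (6<W : 6 < W) (N≡ : 2 * 24 ≡ N) where

  private
    0<N : 0 < N
    0<N = subst (0 <_) N≡ z<s
    0<M : 0 < 6 * K
    0<M = ≤-trans (≤-trans (≤-trans (s≤s z≤n) 6<W) (≤-trans (m≤m+n W _) 2W≤K)) (m≤m+n K _)

  module _ {C₀ C m} (0<C₀ : 0 < C₀) (families : Families Htour z<s (6 * K) N 0<M N≡ C₀)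
    (C₀≤C : C₀ ≤ C) (C₀-star : C₀ * 2 * 6 ≤ C) (C₀-pair : 2 * 24 * C₀ ≤ C) (m-star : 2 * N * 2 ≤ suc m) where

    forcedFrom : Forced H N C m
    forcedFrom {n} T t tour free C≤n N≤t critical = free (embed plan)
      where
      2N≤m : 2 * N ≤ suc m
      2N≤m = ≤-trans (m≤m*n (2 * N) 2) m-star
      2≤m : 2 ≤ suc m
      2≤m = ≤-trans (*-monoʳ-≤ 2 {1} {N} 0<N) 2N≤m
      0<n : 0 < n
      0<n = ≤-trans 0<C₀ (≤-trans C₀≤C C≤n)
      0<t : 0 < t
      0<t = ≤-trans 0<N N≤t
      fam : Family T (6 * K) N t C₀
      fam = families T tour free (≤-trans C₀≤C C≤n) N≤t C₀≤C 2≤m critical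
      embedWith : ∀ {slot own dom pat} → Valid H slot own dom pat → Special T (Family.X fam) dom pat → Embeds T H
      embedWith valid = Embedding.embedding tour {K} {N} {t} {C₀} {C} {suc m} {6} {W} 2W≤K 6<W C₀-star m-star 0<n 0<t critical fam Htour valid
      embed : Plan H → Embeds T H
      embed (stars-only slot own valid) = embedWith valid (record { at = λ _ → vertex T 0<n ; in-X = λ _ () ; arcs = λ _ _ () })
        where
        vertex : ∀ {n} → Digraph n → 0 < n → Fin n
        vertex {suc n} _ _ = zero
      embed (pair-or-triangle slot own slot′ own′ valid valid′) = outcome (pairPiece tour 2≤m 2N≤m C₀-pair critical fam)
        where
        outcome : PairPiece tour 2≤m 2N≤m C₀-pair critical fam → Embeds T H
        outcome (inj₁ sp) = embedWith valid sp
        outcome (inj₂ (j , cj , sp)) = embedWith (valid′ j cj) sp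

  forced : ∃₂ λ C m → 0 < m × Forced H N C m
  forced = from (family Htour z<s (6 * K) N 0<M N≡)
    where
    from : (Σ ℕ λ C → 0 < C × Families Htour z<s (6 * K) N 0<M N≡ C) → ∃₂ λ C m → 0 < m × Forced H N C m
    -- The first summand of `C` pays for six leaves in a half-size slot in `starPiece`, the second
    -- for the 24 intervals in `typical`; in `2 * N * 2` the last factor allows the intervals to be
    -- halved.
    from (C₀ , 0<C₀ , families) = C₀ * 2 * 6 + N * C₀ , 2 * N * 2 , *-mono-≤ (*-mono-≤ {1} {2} (s≤s z≤n) 0<N) (s≤s z≤n) ,
      forcedFrom 0<C₀ families C₀≤C (m≤m+n (C₀ * 2 * 6) (N * C₀)) C₀-pair (n≤1+n (2 * N * 2))
      where
      C₀≤C : C₀ ≤ C₀ * 2 * 6 + N * C₀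
      C₀≤C = ≤-trans (m≤n*m C₀ N {{>-nonZero 0<N}}) (m≤n+m (N * C₀) (C₀ * 2 * 6))
      C₀-pair : 2 * 24 * C₀ ≤ C₀ * 2 * 6 + N * C₀
      C₀-pair = subst (λ k → k * C₀ ≤ C₀ * 2 * 6 + N * C₀) (sym N≡) (m≤n+m (N * C₀) (C₀ * 2 * 6))

-- Bernoulli's inequality `1 + q/a ≤ (1 + 1/a) ^ q`, cleared of denominators.
bernoulli : ∀ a q → a ^ q * (a + q) ≤ a * suc a ^ q
bernoulli a zero = ≤-reflexive (e a)
  where
  e : ∀ a → 1 * (a + 0) ≡ a * 1
  e = solve-∀
bernoulli a (suc q) = begin
  a * a ^ q * (a + suc q)                  ≡⟨ e₁ a q (a ^ q) ⟩
  a * (a ^ q * (a + q)) + a * a ^ q        ≤⟨ +-mono-≤ (*-monoʳ-≤ a (bernoulli a q)) (*-monoʳ-≤ a (^-monoˡ-≤ q (n≤1+n a))) ⟩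
  a * (a * suc a ^ q) + a * suc a ^ q      ≡⟨ e₂ a (suc a ^ q) ⟩
  a * (suc a * suc a ^ q)                  ∎
  where
  open ≤-Reasoning
  e₁ : ∀ a q p → a * p * (a + suc q) ≡ a * (p * (a + q)) + a * p
  e₁ = solve-∀
  e₂ : ∀ a s → a * (a * s) + a * s ≡ a * (suc a * s)
  e₂ = solve-∀

power-ratio : ∀ D a q → 0 < a → D * a ≤ q → D * a ^ q ≤ suc a ^ q
power-ratio D a q 0<a le = cancel 0<a (begin
  a * (D * a ^ q)      ≡⟨ e a D (a ^ q) ⟩
  a ^ q * (D * a)      ≤⟨ *-monoʳ-≤ (a ^ q) (≤-trans le (m≤n+m q a)) ⟩
  a ^ q * (a + q)      ≤⟨ bernoulli a q ⟩
  a * suc a ^ q        ∎)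
  where
  open ≤-Reasoning
  e : ∀ a d p → a * (d * p) ≡ p * (d * a)
  e = solve-∀

^-distribʳ-* : ∀ a b q → (a * b) ^ q ≡ a ^ q * b ^ q
^-distribʳ-* a b zero = refl
^-distribʳ-* a b (suc q) rewrite ^-distribʳ-* a b q = e a b (a ^ q) (b ^ q)
  where
  e : ∀ a b c d → a * b * (c * d) ≡ a * c * (b * d)
  e = solve-∀

module _ {n} {T : Digraph n} (tour : IsTournament T) where

  open Tournament tour

  Subchain : ℕ → List (Fin n) → Set
  Subchain k A = Σ (List (Fin n)) λ l → Chain T l × (∀ x → x ∈ l → x ∈ A) × length l ≡ k

  -- One of the two neighbourhoods of the first vertex contains `2 ^ k` of the others; the vertex is
  -- put in front of or behind the chain found there.
  logChain : ∀ k A → Unique A → 2 ^ k ≤ length A → Subchain k A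
  logChain zero A _ _ = [] , [] , (λ _ ()) , refl
  logChain (suc k) [] _ le = ⊥-elim (<⇒≱ (m^n>0 2 (suc k)) le)
  logChain (suc k) (x ∷ xs) (x∉ ∷ uniq) le with 2 ^ k ≤? length (filterᵇ (T x) xs)
  ... | yes big with logChain k (filterᵇ (T x) xs) (AllPairs-⊆ (filterᵇ-⊆ _ xs) uniq) big
  ...   | l , ch , l∈ , e = x ∷ l , All.tabulate (λ y∈ → proj₂ (∈-filterᵇ⁻ (T x) {xs = xs} (l∈ _ y∈))) ∷ ch ,
          (λ { y (here refl) → here refl ; y (there y∈) → there (proj₁ (∈-filterᵇ⁻ (T x) {xs = xs} (l∈ y y∈))) }) , cong suc e
  logChain (suc k) (x ∷ xs) (x∉ ∷ uniq) le | no small with logChain k Z (AllPairs-⊆ (filterᵇ-⊆ _ xs) uniq) big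
    where
    open ≤-Reasoning
    Z = filterᵇ (not ∘ T x) xs
    big : 2 ^ k ≤ length Z
    big = +-cancelˡ-≤ (2 ^ k) _ _ (begin
      2 ^ k + 2 ^ k                              ≡⟨ cong (2 ^ k +_) (sym (+-identityʳ _)) ⟩
      2 ^ suc k                                  ≤⟨ le ⟩
      suc (length xs)                            ≡⟨ cong suc (sym (cnt-split (T x) xs)) ⟩
      suc (cnt (T x) xs + cnt (not ∘ T x) xs)    ≡⟨ cong₂ (λ a b → suc (a + b)) (sym (length-filterᵇ _ xs)) (sym (length-filterᵇ _ xs)) ⟩
      suc (length (filterᵇ (T x) xs)) + length Z ≤⟨ +-monoˡ-≤ (length Z) (≰⇒> small) ⟩
      2 ^ k + length Z                           ∎)
  ... | l , ch , l∈ , e = l ++ x ∷ [] ,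
        AllPairs.++⁺ ch ([] ∷ []) (All.tabulate λ y∈ → back y∈ ∷ []) , sub , trans (length-++ l) (trans (+-comm (length l) 1) (cong suc e))
    where
    z∈ : ∀ {y} → y ∈ l → y ∈ xs × not (T x y) ≡ true
    z∈ y∈ = ∈-filterᵇ⁻ (not ∘ T x) {xs = xs} (l∈ _ y∈)
    not-true : ∀ {b} → not b ≡ true → b ≡ false
    not-true {false} _ = refl
    back : ∀ {y} → y ∈ l → T y x ≡ true
    back y∈ = flip-false (All.lookup x∉ (proj₁ (z∈ y∈))) (not-true (proj₂ (z∈ y∈)))
    sub : ∀ y → y ∈ l ++ x ∷ [] → y ∈ x ∷ xs
    sub y y∈ with ∈-++⁻ l y∈
    ... | inj₁ y∈l = there (proj₁ (z∈ y∈l))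
    ... | inj₂ (here refl) = here refl

  -- An exhaustive search over the first vertex, which lets `improve` decide whether a chain of the
  -- current length is longest.
  subchain? : ∀ k A → Dec (Subchain k A)
  subchain? zero A = yes ([] , [] , (λ _ ()) , refl)
  subchain? (suc k) A with Any.any? (λ x → subchain? k (filterᵇ (T x) A)) A
  ... | yes p with find p
  ...   | x , x∈ , l , ch , l∈ , e = yes (x ∷ l , All.tabulate (λ y∈ → proj₂ (∈-filterᵇ⁻ (T x) {xs = A} (l∈ _ y∈))) ∷ ch ,
          (λ { y (here refl) → x∈ ; y (there y∈) → proj₁ (∈-filterᵇ⁻ (T x) {xs = A} (l∈ y y∈)) }) , cong suc e)
  subchain? (suc k) A | no none = no refute
    where
    refute : ¬ Subchain (suc k) A
    refute (x ∷ l , x→ ∷ ch , l∈ , e) = none (lose (l∈ x (here refl)) (l , ch ,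
      (λ y y∈ → ∈-filterᵇ⁺ (T x) (l∈ y (there y∈)) (All.lookup x→ y∈)) , suc-injective e))

  -- The counting behind minimal counterexamples: t ^ q < n ≤ 2 C r ≤ 2 C |l| ^ q forces |l| to be close to t.
  critical : ∀ q t C m → 0 < m → t ^ q < n → 2 ≤ n → 2 * C * m ≤ q →
    (∀ l → Chain T l → length l ≤ t) →
    (∀ A → Unique A → length A < n → Σ (List (Fin n)) λ l → Chain T l × (∀ x → x ∈ l → x ∈ A) × length A ≤ length l ^ q) →
    Critical T t C (suc m)
  critical q t C m 0<m t^q<n 2≤n Cm≤q short ih = record { short = short ; long = long }
    where
    open ≤-Reasoning
    close : ∀ {r s} → n ≤ 2 * C * r → r ≤ s ^ q → suc m * t < suc m * s + t
    close {r} {s} n≤ r≤ = ≰⇒> λ le → <⇒≱ t^q<n (cancel (m^n>0 (suc m) q) (begin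
      suc m ^ q * n                      ≤⟨ *-monoʳ-≤ (suc m ^ q) (≤-trans n≤ (*-monoʳ-≤ (2 * C) r≤)) ⟩
      suc m ^ q * (2 * C * s ^ q)        ≡⟨ e₁ (suc m ^ q) (2 * C) (s ^ q) ⟩
      2 * C * (suc m ^ q * s ^ q)        ≡⟨ cong (2 * C *_) (sym (^-distribʳ-* (suc m) s q)) ⟩
      2 * C * (suc m * s) ^ q            ≤⟨ *-monoʳ-≤ (2 * C) (^-monoˡ-≤ q (+-cancelʳ-≤ t _ _ (≤-trans le (≤-reflexive (+-comm t (m * t)))))) ⟩
      2 * C * (m * t) ^ q                ≡⟨ cong (2 * C *_) (^-distribʳ-* m t q) ⟩
      2 * C * (m ^ q * t ^ q)            ≡⟨ sym (*-assoc (2 * C) (m ^ q) (t ^ q)) ⟩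
      2 * C * m ^ q * t ^ q              ≤⟨ *-monoˡ-≤ (t ^ q) (power-ratio (2 * C) m q 0<m Cm≤q) ⟩
      suc m ^ q * t ^ q                  ∎))
      where
      e₁ : ∀ a b c → a * (b * c) ≡ b * (a * c)
      e₁ = solve-∀
    long : ∀ A → Unique A → n ≤ C * length A →
      Σ (List (Fin n)) λ l → Chain T l × (∀ x → x ∈ l → x ∈ A) × suc m * t < suc m * length l + t
    long A uniq big with length A <? n
    ... | yes lt with ih A uniq lt
    ...   | l , ch , l∈ , le = l , ch , l∈ , close (≤-trans big (*-monoˡ-≤ (length A) (m≤m+n C _))) le
    -- The induction hypothesis reaches proper subsets only. Dropping one vertex costs at most a
    -- factor 2, which is the 2 in `2 * C * m`.
    long A uniq big | no ≮ with ih A′ (AllPairs-⊆ (take-⊆ (n ∸ 1) A) uniq) (subst (_< n) (sym A′-length) n∸1<n)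
      where
      A′ = take (n ∸ 1) A
      A′-length : length A′ ≡ n ∸ 1
      A′-length = trans (length-take (n ∸ 1) A) (m≤n⇒m⊓n≡m (≤-trans (m∸n≤m n 1) (≮⇒≥ ≮)))
      n∸1<n : n ∸ 1 < n
      n∸1<n = ∸-monoʳ-< {n} {1} {0} z<s (≤-trans (n≤1+n 1) 2≤n)
    ...   | l , ch , l∈ , le = l , ch , (λ x x∈ → ⊆-lookup (take-⊆ (n ∸ 1) A) (l∈ x x∈)) ,
            close n≤ (subst (_≤ length l ^ q) (trans (length-take (n ∸ 1) A) (m≤n⇒m⊓n≡m (≤-trans (m∸n≤m n 1) (≮⇒≥ ≮)))) le)
      where
      n≤2 : ∀ {n} → 2 ≤ n → n ≤ 2 * (n ∸ 1)
      n≤2 {suc (suc n)} _ = s≤s (≤-trans (m≤n+m (suc n) n) (≤-reflexive (cong (n +_) (sym (+-identityʳ (suc n))))))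
      n≤2 {suc zero} (s≤s ())
      0<C : 0 < C
      0<C = n≢0⇒n>0 λ { refl → <⇒≱ (≤-trans (s≤s z≤n) 2≤n) big }
      n≤ : n ≤ 2 * C * (n ∸ 1)
      n≤ = begin
        n                  ≤⟨ n≤2 2≤n ⟩
        2 * (n ∸ 1)        ≤⟨ *-monoˡ-≤ (n ∸ 1) (*-monoʳ-≤ 2 0<C) ⟩
        2 * C * (n ∸ 1)    ∎

EH : ∀ {h} → Digraph h → ℕ → Set
EH H q = ∀ n (T : Digraph n) → IsTournament T → ¬ Embeds T H → Σ (List (Fin n)) λ l → Chain T l × n ≤ length l ^ q

module _ {h} {H : Digraph h} {N C m} (forced : Forced H N C m) (0<m : 0 < m) where

  private
    K = 2 + N
    -- `K` makes a chain of two vertices suffice when `n < 2 ^ K`; `C` gives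
    -- `C < 2 ^ q ≤ t ^ q < n`, using `t ≥ 2`; `2 * C * m` is what `power-ratio` asks for.
    q = K + C + 2 * C * m
    K≤q : K ≤ q
    K≤q = ≤-trans (m≤m+n K C) (m≤m+n (K + C) _)
    n<2^n : ∀ n → n < 2 ^ n
    n<2^n zero = z<s
    n<2^n (suc n) = +-mono-≤ (m^n>0 2 n) (≤-trans (n<2^n n) (≤-reflexive (sym (+-identityʳ _))))
    t≤t^q : ∀ t → t ≤ t ^ q
    t≤t^q zero = z≤n
    t≤t^q t@(suc _) = ≤-trans (≤-reflexive (sym (*-identityʳ t))) (*-monoʳ-≤ t (m^n>0 t (suc N + C + 2 * C * m)))

  Forced⇒EH : ∃ λ q → 0 < q × EH H q
  Forced⇒EH = q , z<s , <-rec (λ n → ∀ (T : Digraph n) → IsTournament T → ¬ Embeds T H → Σ (List (Fin n)) λ l → Chain T l × n ≤ length l ^ q) step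
    where
    step : ∀ n → (∀ {k} → k < n → ∀ (T : Digraph k) → IsTournament T → ¬ Embeds T H → Σ (List (Fin k)) λ l → Chain T l × k ≤ length l ^ q) →
      ∀ (T : Digraph n) → IsTournament T → ¬ Embeds T H → Σ (List (Fin n)) λ l → Chain T l × n ≤ length l ^ q
    step zero _ T _ _ = [] , [] , z≤n
    step (suc zero) _ T _ _ = zero ∷ [] , [] ∷ [] , m^n>0 1 q
    step n@(suc (suc _)) rec T tour free with 2 ^ K ≤? n
    ... | no small with any-pair
      where
      any-pair : Subchain tour 2 (allFin n)
      any-pair with T zero (suc zero) in e
      ... | true = zero ∷ suc zero ∷ [] , (e ∷ []) ∷ [] ∷ [] , (λ x _ → ∈-allFin x) , refl
      ... | false = suc zero ∷ zero ∷ [] , (Tournament.flip-false tour (λ ()) e ∷ []) ∷ [] ∷ [] , (λ x _ → ∈-allFin x) , refl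
    ...   | l , ch , _ , e = l , ch , subst (λ k → n ≤ k ^ q) (sym e) (≤-trans (<⇒≤ (≰⇒> small)) (^-monoʳ-≤ 2 K≤q))
    step n@(suc (suc _)) rec T tour free | yes big with logChain tour K (allFin n) (allFin⁺ n) (≤-trans big (≤-reflexive (sym (length-tabulate {n = n} id))))
    ... | start = improve n K ≤-refl (m≤n+m n K) start
      where
      ih : ∀ A → Unique A → length A < n → Σ (List (Fin n)) λ l → Chain T l × (∀ x → x ∈ l → x ∈ A) × length A ≤ length l ^ q
      ih A uniq lt with rec lt (induced T (lookup A)) sub-tour (λ (f , arcs) → free (lookup A ∘ f , arcs))
        where
        lookup-injective : ∀ {A : List (Fin n)} → Unique A → ∀ i j → lookup A i ≡ lookup A j → i ≡ j
        lookup-injective (_ ∷ _) zero zero _ = refl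
        lookup-injective {_ ∷ A} (a ∷ _) zero (suc j) e = ⊥-elim (All.lookup a (∈-lookup j) e)
        lookup-injective {_ ∷ A} (a ∷ _) (suc i) zero e = ⊥-elim (All.lookup a (∈-lookup i) (sym e))
        lookup-injective (_ ∷ u) (suc i) (suc j) e = cong suc (lookup-injective u i j e)
        sub-tour : IsTournament (induced T (lookup A))
        sub-tour = record
          { irrefl = λ x → IsTournament.irrefl tour (lookup A x)
          ; total = λ x y x≢y → IsTournament.total tour (lookup A x) (lookup A y) (x≢y ∘ lookup-injective uniq x y) }
      ... | l , ch , le = map (lookup A) l , AllPairs.map⁺ ch , sub , subst (λ k → length A ≤ k ^ q) (sym (length-map (lookup A) l)) le
        where
        sub : ∀ x → x ∈ map (lookup A) l → x ∈ A
        sub x x∈ with ∈-map⁻ (lookup A) x∈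
        ... | i , _ , refl = ∈-lookup i
      -- While `t ^ q < n`, a chain of length `t` that is longest would make `T` critical, which
      -- `forced` excludes; so a longer one exists. The invariant `n ≤ t + fuel` ends the process at
      -- `n ≤ t ≤ t ^ q`.
      improve : ∀ fuel t → K ≤ t → n ≤ t + fuel → Subchain tour t (allFin n) → Σ (List (Fin n)) λ l → Chain T l × n ≤ length l ^ q
      improve zero t K≤t le (l , ch , _ , e) = l , ch , ≤-trans (≤-trans le (≤-reflexive (+-identityʳ t))) (≤-trans (t≤t^q t) (≤-reflexive (cong (_^ q) (sym e))))
      improve (suc fuel) t K≤t le (l , ch , _ , e) with n ≤? t ^ q
      ... | yes n≤ = l , ch , subst (λ k → n ≤ k ^ q) (sym e) n≤
      ... | no n≰ with subchain? tour (suc t) (allFin n)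
      ...   | yes longer = improve fuel (suc t) (m≤n⇒m≤1+n K≤t) (≤-trans le (≤-reflexive (+-suc t fuel))) longer
      ...   | no ¬longer = ⊥-elim (forced T t tour free C≤n (≤-trans (m≤n+m N 2) K≤t)
                (critical tour q t C m 0<m (≰⇒> n≰) (s≤s (s≤s z≤n)) (m≤n+m _ (K + C)) short ih))
        where
        open ≤-Reasoning
        short : ∀ l → Chain T l → length l ≤ t
        short l ch = ≮⇒≥ λ lt → ¬longer (take (suc t) l , AllPairs-⊆ (take-⊆ (suc t) l) ch , (λ x _ → ∈-allFin x) ,
          trans (length-take (suc t) l) (m≤n⇒m⊓n≡m lt))
        C≤n : C ≤ n
        C≤n = begin
          C        ≤⟨ ≤-trans (m≤n+m C K) (m≤m+n (K + C) _) ⟩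
          q        ≤⟨ <⇒≤ (n<2^n q) ⟩
          2 ^ q    ≤⟨ ^-monoˡ-≤ q (≤-trans (m≤m+n 2 N) K≤t) ⟩
          t ^ q    ≤⟨ <⇒≤ (≰⇒> n≰) ⟩
          n        ∎

-- The tournaments on six vertices

digit : (b : ℕ) .{{_ : NonZero b}} → ℕ → ℕ → ℕ
digit b zero c = c % b
digit b (suc i) c = digit b i (c / b)

-- The number `j (j - 1) / 2` of entries above the diagonal in the columns before column `j`.
triangular : ℕ → ℕ
triangular zero = 0
triangular (suc j) = j + triangular j

-- The binary digits of c are the entries above the diagonal, column by column.
decode : ∀ k → ℕ → Digraph k
decode k c x y = if toℕ x <ᵇ toℕ y then arcBit (toℕ x) (toℕ y)
  else if toℕ y <ᵇ toℕ x then not (arcBit (toℕ y) (toℕ x)) else false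
  where
  arcBit : ℕ → ℕ → Bool
  arcBit i j = digit 2 (triangular j + i) c ≡ᵇ 1

decode-isTournament : ∀ k c → IsTournament (decode k c)
decode-isTournament k c = record { irrefl = irrefl ; total = total }
  where
  irrefl : ∀ x → decode k c x x ≡ false
  irrefl x rewrite <ᵇ-false (n≮n (toℕ x)) = refl
  total : ∀ x y → x ≢ y → decode k c x y ≡ not (decode k c y x)
  total x y x≢y with Finₚ.<-cmp x y
  ... | tri< lt _ ≯ rewrite <ᵇ-true lt | <ᵇ-false ≯ with digit 2 (triangular (toℕ y) + toℕ x) c ≡ᵇ 1
  ...   | true = refl
  ...   | false = refl
  total x y x≢y | tri≈ _ e _ = ⊥-elim (x≢y e)
  total x y x≢y | tri> ≮ _ gt rewrite <ᵇ-true gt | <ᵇ-false ≮ = refl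

-- The new vertex is zero.
extend : ∀ {k} → Vec Bool k → Digraph k → Digraph (suc k)
extend v H zero zero = false
extend v H zero (suc y) = Vec.lookup v y
extend v H (suc x) zero = not (Vec.lookup v x)
extend v H (suc x) (suc y) = H x y

-- Codes of the tournaments on k vertices up to isomorphism, each with a list, indexed by binary numbers v,
-- of its one-vertex extensions: the code (c , p) says that decode (suc k) c is the extension
-- with its vertices permuted by the decimal digits of p.
table : ℕ → List (ℕ × List (ℕ × ℕ))
table 0 =
  (0 ,
    (0 , 0) ∷ []) ∷
  []
table 1 =
  (0 ,
    (1 , 1) ∷ (1 , 10) ∷ []) ∷
  []
table 2 =
  (1 ,
    (7 , 21) ∷ (5 , 210) ∷ (7 , 201) ∷ (7 , 210) ∷ []) ∷
  []
table 3 =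
  (7 ,
    (63 , 321) ∷ (55 , 321) ∷ (47 , 3201) ∷ (55 , 3210) ∷ (63 , 3021) ∷ (23 , 2310) ∷ (63 , 3201) ∷ (63 , 3210) ∷ []) ∷
  (5 ,
    (23 , 3021) ∷ (55 , 1032) ∷ (55 , 2013) ∷ (55 , 2103) ∷ (55 , 3021) ∷ (55 , 1302) ∷ (55 , 3201) ∷ (47 , 3210) ∷ []) ∷
  []
table 4 =
  (63 ,
    (1023 , 4321) ∷ (959 , 4321) ∷ (895 , 4321) ∷ (831 , 4321) ∷ (767 , 43021) ∷ (703 , 4321) ∷ (895 , 43201) ∷ (959 , 43210) ∷
    (1023 , 40321) ∷ (447 , 4321) ∷ (383 , 34201) ∷ (447 , 34210) ∷ (1023 , 43021) ∷ (191 , 24310) ∷ (1023 , 43201) ∷ (1023 , 43210) ∷ []) ∷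
  (55 ,
    (447 , 40321) ∷ (831 , 10432) ∷ (431 , 40321) ∷ (823 , 43210) ∷ (703 , 43021) ∷ (431 , 13042) ∷ (831 , 43201) ∷ (831 , 43210) ∷
    (959 , 40321) ∷ (831 , 14032) ∷ (943 , 43201) ∷ (431 , 34210) ∷ (959 , 43021) ∷ (703 , 14302) ∷ (959 , 43201) ∷ (895 , 43210) ∷ []) ∷
  (23 ,
    (191 , 40321) ∷ (703 , 10342) ∷ (703 , 20314) ∷ (431 , 23104) ∷ (191 , 43021) ∷ (447 , 13042) ∷ (447 , 23014) ∷ (447 , 23104) ∷
    (703 , 40321) ∷ (431 , 13402) ∷ (431 , 43201) ∷ (943 , 34210) ∷ (447 , 43021) ∷ (447 , 13402) ∷ (447 , 43201) ∷ (383 , 43210) ∷ []) ∷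
  (47 ,
    (383 , 40321) ∷ (943 , 4321) ∷ (895 , 20431) ∷ (431 , 2431) ∷ (895 , 30241) ∷ (431 , 3241) ∷ (895 , 32041) ∷ (703 , 43210) ∷
    (895 , 40321) ∷ (431 , 4321) ∷ (895 , 24031) ∷ (703 , 32410) ∷ (895 , 43021) ∷ (703 , 24310) ∷ (767 , 43201) ∷ (767 , 43210) ∷ []) ∷
  []
table 5 =
  (1023 ,
    (32767 , 54321) ∷ (31743 , 54321) ∷ (30719 , 54321) ∷ (29695 , 54321) ∷ (28671 , 54321) ∷ (27647 , 54321) ∷ (26623 , 54321) ∷ (25599 , 54321) ∷
    (24575 , 540321) ∷ (23551 , 54321) ∷ (22527 , 54321) ∷ (21503 , 54321) ∷ (28671 , 543021) ∷ (19455 , 54321) ∷ (30719 , 543201) ∷ (31743 , 543210) ∷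
    (32767 , 504321) ∷ (15359 , 54321) ∷ (14335 , 54321) ∷ (13311 , 54321) ∷ (12287 , 453021) ∷ (11263 , 54321) ∷ (14335 , 453201) ∷ (15359 , 453210) ∷
    (32767 , 540321) ∷ (7167 , 54321) ∷ (6143 , 354201) ∷ (7167 , 354210) ∷ (32767 , 543021) ∷ (3071 , 254310) ∷ (32767 , 543201) ∷ (32767 , 543210) ∷ []) ∷
  (959 ,
    (15359 , 504321) ∷ (25599 , 105432) ∷ (15231 , 504321) ∷ (29631 , 54321) ∷ (15103 , 504321) ∷ (25471 , 105432) ∷ (14975 , 504321) ∷ (29631 , 543210) ∷
    (23551 , 540321) ∷ (13055 , 140532) ∷ (14719 , 504321) ∷ (21439 , 54321) ∷ (27647 , 543021) ∷ (19327 , 154302) ∷ (29695 , 543201) ∷ (29695 , 543210) ∷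
    (31743 , 504321) ∷ (25599 , 150432) ∷ (31615 , 504321) ∷ (13247 , 54321) ∷ (31487 , 543021) ∷ (10623 , 145302) ∷ (31615 , 543201) ∷ (15231 , 453210) ∷
    (31743 , 540321) ∷ (21503 , 154032) ∷ (31103 , 534201) ∷ (7039 , 354210) ∷ (31743 , 543021) ∷ (19455 , 154302) ∷ (31743 , 543201) ∷ (30719 , 543210) ∷ []) ∷
  (447 ,
    (7167 , 504321) ∷ (21503 , 104532) ∷ (7039 , 504321) ∷ (21439 , 104532) ∷ (6911 , 504321) ∷ (10879 , 130452) ∷ (6783 , 504321) ∷ (13247 , 543210) ∷
    (7167 , 540321) ∷ (13311 , 140532) ∷ (6527 , 504321) ∷ (20927 , 534210) ∷ (11263 , 543021) ∷ (6527 , 134052) ∷ (13311 , 543201) ∷ (13311 , 543210) ∷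
    (23551 , 504321) ∷ (13055 , 145032) ∷ (23423 , 504321) ∷ (12735 , 54321) ∷ (15103 , 543021) ∷ (11135 , 145302) ∷ (15231 , 543201) ∷ (31615 , 453210) ∷
    (15359 , 540321) ∷ (13311 , 145032) ∷ (22911 , 534201) ∷ (6527 , 354210) ∷ (15359 , 543021) ∷ (11263 , 145302) ∷ (15359 , 543201) ∷ (14335 , 543210) ∷ []) ∷
  (831 ,
    (13311 , 504321) ∷ (13247 , 504321) ∷ (6783 , 520431) ∷ (29503 , 54321) ∷ (13055 , 504321) ∷ (12991 , 504321) ∷ (25471 , 543201) ∷ (29631 , 432105) ∷
    (21503 , 540321) ∷ (12735 , 504321) ∷ (10623 , 524031) ∷ (13247 , 342105) ∷ (25599 , 543021) ∷ (12479 , 524310) ∷ (25599 , 543201) ∷ (25599 , 543210) ∷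
    (29695 , 504321) ∷ (29631 , 504321) ∷ (14975 , 520431) ∷ (29503 , 432150) ∷ (29439 , 543021) ∷ (29375 , 504321) ∷ (27519 , 543201) ∷ (14975 , 453210) ∷
    (29695 , 540321) ∷ (21439 , 154032) ∷ (14719 , 524031) ∷ (6783 , 354210) ∷ (29695 , 543021) ∷ (19327 , 254310) ∷ (27647 , 543201) ∷ (26623 , 543210) ∷ []) ∷
  (191 ,
    (3071 , 504321) ∷ (19455 , 104352) ∷ (19455 , 204315) ∷ (19327 , 204315) ∷ (2815 , 543021) ∷ (6911 , 143052) ∷ (6911 , 243015) ∷ (7039 , 243105) ∷
    (3071 , 540321) ∷ (11263 , 140352) ∷ (11263 , 240315) ∷ (6527 , 234105) ∷ (3071 , 543021) ∷ (7167 , 143052) ∷ (7167 , 243015) ∷ (7167 , 243105) ∷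
    (19455 , 504321) ∷ (19327 , 104352) ∷ (19327 , 504321) ∷ (12479 , 54321) ∷ (6911 , 543021) ∷ (7039 , 143502) ∷ (7039 , 543201) ∷ (31103 , 453210) ∷
    (11263 , 540321) ∷ (6527 , 134502) ∷ (6527 , 534201) ∷ (22911 , 354210) ∷ (7167 , 543021) ∷ (7167 , 143502) ∷ (7167 , 543201) ∷ (6143 , 543210) ∷ []) ∷
  (703 ,
    (11263 , 504321) ∷ (10623 , 140352) ∷ (11135 , 504321) ∷ (29375 , 54321) ∷ (6911 , 530421) ∷ (6783 , 143052) ∷ (10879 , 504321) ∷ (21439 , 543210) ∷
    (19455 , 540321) ∷ (11135 , 140352) ∷ (10623 , 504321) ∷ (12735 , 534210) ∷ (19455 , 543021) ∷ (7039 , 143052) ∷ (21503 , 543201) ∷ (21503 , 543210) ∷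
    (27647 , 504321) ∷ (25471 , 150432) ∷ (27519 , 504321) ∷ (12991 , 54321) ∷ (15103 , 530421) ∷ (6783 , 143502) ∷ (23423 , 543201) ∷ (14719 , 453210) ∷
    (27647 , 540321) ∷ (10879 , 135402) ∷ (14719 , 534201) ∷ (23423 , 354210) ∷ (23551 , 543021) ∷ (6911 , 143502) ∷ (23551 , 543201) ∷ (22527 , 543210) ∷ []) ∷
  (895 ,
    (14335 , 504321) ∷ (31615 , 54321) ∷ (26623 , 205431) ∷ (14975 , 25431) ∷ (14079 , 504321) ∷ (27519 , 54321) ∷ (26495 , 543201) ∷ (25471 , 54321) ∷
    (22527 , 540321) ∷ (23423 , 54321) ∷ (14079 , 240531) ∷ (10879 , 25431) ∷ (26623 , 543021) ∷ (19327 , 54321) ∷ (26623 , 543201) ∷ (27647 , 543210) ∷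
    (30719 , 504321) ∷ (15231 , 54321) ∷ (26623 , 250431) ∷ (6783 , 25431) ∷ (30463 , 543021) ∷ (11135 , 54321) ∷ (14079 , 453201) ∷ (15103 , 453210) ∷
    (30719 , 540321) ∷ (7039 , 54321) ∷ (22527 , 254031) ∷ (6911 , 354210) ∷ (30719 , 543021) ∷ (19455 , 254310) ∷ (28671 , 543201) ∷ (28671 , 543210) ∷ []) ∷
  (383 ,
    (6143 , 504321) ∷ (31103 , 54321) ∷ (22527 , 204531) ∷ (14719 , 24531) ∷ (22527 , 304251) ∷ (14719 , 34251) ∷ (14079 , 342051) ∷ (10623 , 34251) ∷
    (6143 , 540321) ∷ (22911 , 54321) ∷ (14335 , 240531) ∷ (6527 , 24531) ∷ (14335 , 340251) ∷ (6527 , 34251) ∷ (14335 , 342051) ∷ (11263 , 543210) ∷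
    (22527 , 504321) ∷ (14719 , 54321) ∷ (14079 , 245031) ∷ (10623 , 24531) ∷ (14079 , 543021) ∷ (10623 , 54321) ∷ (30463 , 453201) ∷ (31487 , 453210) ∷
    (14335 , 540321) ∷ (6527 , 54321) ∷ (14335 , 245031) ∷ (11263 , 342510) ∷ (14335 , 543021) ∷ (11263 , 245310) ∷ (12287 , 543201) ∷ (12287 , 543210) ∷ []) ∷
  (767 ,
    (12287 , 504321) ∷ (31487 , 54321) ∷ (30463 , 54321) ∷ (29439 , 54321) ∷ (28671 , 305421) ∷ (15103 , 35421) ∷ (14079 , 35421) ∷ (13055 , 35421) ∷
    (28671 , 403521) ∷ (15103 , 43521) ∷ (14079 , 43521) ∷ (13055 , 43521) ∷ (28671 , 430521) ∷ (6911 , 43521) ∷ (22527 , 543201) ∷ (23551 , 543210) ∷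
    (28671 , 504321) ∷ (15103 , 54321) ∷ (14079 , 54321) ∷ (13055 , 54321) ∷ (28671 , 350421) ∷ (6911 , 35421) ∷ (22527 , 435201) ∷ (23551 , 435210) ∷
    (28671 , 540321) ∷ (6911 , 54321) ∷ (22527 , 354201) ∷ (23551 , 354210) ∷ (24575 , 543021) ∷ (2815 , 254310) ∷ (24575 , 543201) ∷ (24575 , 543210) ∷ []) ∷
  (431 ,
    (6527 , 540321) ∷ (12735 , 140532) ∷ (19327 , 520431) ∷ (29375 , 210453) ∷ (10879 , 543021) ∷ (27511 , 45321) ∷ (25471 , 532041) ∷ (12991 , 543210) ∷
    (7039 , 540321) ∷ (13247 , 140532) ∷ (19327 , 524031) ∷ (21439 , 324105) ∷ (11135 , 543021) ∷ (12735 , 234105) ∷ (13055 , 543201) ∷ (13055 , 543210) ∷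
    (14719 , 540321) ∷ (12991 , 145032) ∷ (27519 , 520431) ∷ (27511 , 453210) ∷ (14975 , 543021) ∷ (29375 , 415302) ∷ (14975 , 543201) ∷ (27519 , 453210) ∷
    (15231 , 540321) ∷ (13247 , 145032) ∷ (23423 , 524031) ∷ (10879 , 352410) ∷ (15231 , 543021) ∷ (10623 , 254310) ∷ (15103 , 543201) ∷ (14079 , 543210) ∷ []) ∷
  (823 ,
    (20927 , 540321) ∷ (21439 , 210543) ∷ (21439 , 320154) ∷ (29631 , 210543) ∷ (21439 , 430215) ∷ (29375 , 321054) ∷ (29631 , 320154) ∷ (29631 , 321054) ∷
    (21439 , 540321) ∷ (29375 , 154032) ∷ (29375 , 432015) ∷ (12991 , 342105) ∷ (29631 , 430215) ∷ (12991 , 514302) ∷ (29631 , 432015) ∷ (25471 , 543210) ∷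
    (21439 , 150432) ∷ (29631 , 150432) ∷ (29375 , 215043) ∷ (29631 , 215043) ∷ (29375 , 543021) ∷ (12991 , 231504) ∷ (12991 , 453201) ∷ (25471 , 432150) ∷
    (29631 , 540321) ∷ (29631 , 154032) ∷ (12991 , 125403) ∷ (25471 , 321540) ∷ (29631 , 543021) ∷ (25471 , 215430) ∷ (25471 , 154320) ∷ (26495 , 543210) ∷ []) ∷
  (943 ,
    (22911 , 540321) ∷ (12479 , 140532) ∷ (23423 , 520431) ∷ (12991 , 120543) ∷ (23423 , 530241) ∷ (12991 , 130524) ∷ (27519 , 532041) ∷ (29375 , 543210) ∷
    (23423 , 540321) ∷ (12991 , 140532) ∷ (27519 , 524031) ∷ (29375 , 532410) ∷ (27519 , 543021) ∷ (29375 , 524310) ∷ (29439 , 543201) ∷ (29439 , 543210) ∷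
    (31103 , 540321) ∷ (12479 , 145032) ∷ (31615 , 520431) ∷ (12735 , 125043) ∷ (31615 , 530241) ∷ (12735 , 135024) ∷ (31615 , 532041) ∷ (11135 , 453210) ∷
    (31615 , 540321) ∷ (12735 , 145032) ∷ (31615 , 524031) ∷ (11135 , 352410) ∷ (31615 , 543021) ∷ (11135 , 254310) ∷ (31487 , 543201) ∷ (30463 , 543210) ∷ []) ∷
  []
table _ = []

-- Slots are coded by pairs of decimal digits: i for lin i, 10 + j for mid j, and 99 for the slot of the triangle.
-- Owners are coded by one digit, with 9 for nothing.
data Scheme : Set where
  stars : (slots owners : ℕ) → Scheme
  pair : (slots owners slots′ owners′ : ℕ) → Scheme

schemes : List (ℕ × Scheme)
schemes =
  (32767 , stars 151413121110 543210) ∷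
  (31743 , stars 31413121110 543215) ∷
  (15359 , stars 31413121110 553215) ∷
  (25599 , stars 31413121110 543555) ∷
  (7167 , stars 31413121110 555215) ∷
  (21503 , stars 31413121110 545255) ∷
  (13311 , stars 31413121110 553255) ∷
  (29695 , stars 31413121110 543255) ∷
  (3071 , stars 31413121110 555515) ∷
  (19455 , stars 31413121110 545515) ∷
  (11263 , stars 31413121110 553515) ∷
  (27647 , stars 31413121110 543515) ∷
  (23551 , stars 31413121110 545215) ∷
  (30719 , stars 31413121110 543250) ∷
  (14335 , stars 31413121110 553250) ∷
  (26623 , stars 31413121110 543550) ∷
  (6143 , stars 31413121110 555250) ∷
  (22527 , stars 31413121110 545250) ∷
  (28671 , stars 31413121110 543510) ∷
  (12287 , stars 31413121110 553510) ∷
  (24575 , stars 31413121110 545210) ∷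
  (15231 , stars 130312111000 43240) ∷
  (29631 , pair 42320181601 993299 990411100301 991119) ∷
  (7039 , stars 120313111000 43240) ∷
  (21439 , pair 42320181601 999299 990430022901 993229) ∷
  (13247 , stars 313121110 545514) ∷
  (19327 , stars 40313121110 545545) ∷
  (10623 , stars 101303120011 313211) ∷
  (25471 , pair 160104232019 999919 19904110310 999110) ∷
  (13055 , stars 30413121110 543455) ∷
  (31615 , stars 40313121110 543245) ∷
  (14975 , stars 130312111000 43440) ∷
  (31103 , stars 40313121110 544245) ∷
  (14719 , stars 130312111000 44240) ∷
  (31487 , stars 40313121110 543415) ∷
  (15103 , stars 130312111000 43410) ∷
  (6527 , stars 120313111000 44240) ∷
  (20927 , pair 42122181601 999299 990405100301 993119) ∷
  (12735 , stars 1213111001 505510) ∷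
  (11135 , stars 30413121110 543545) ∷
  (10879 , stars 120311041000 42240) ∷
  (6783 , stars 120313111000 43440) ∷
  (22911 , stars 121113100100 13210) ∷
  (23423 , stars 40313121110 545245) ∷
  (6911 , stars 120313111000 43410) ∷
  (29503 , stars 131211100300 1110) ∷
  (12479 , stars 1113121001 505510) ∷
  (29375 , pair 42118031601 992299 41003290199 933299) ∷
  (12991 , pair 11604210218 999911 10399041110 949914) ∷
  (27519 , stars 40313121110 543545) ∷
  (29439 , stars 40313121110 543455) ∷
  (2815 , stars 110313121000 43410) ∷
  (14079 , stars 130312110010 143411) ∷
  (26495 , pair 42320180117 993999 990410030100 992290) ∷
  (30463 , stars 40313121110 543450) ∷
  []

slotAt : Fin 24 → ℕ → Fin 6 → Slot
slotAt j s x = if d <ᵇ 10 then lin (d mod 6) else if d ≡ᵇ 99 then mid j else mid ((d ∸ 10) mod 24)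
  where
  d = digit 100 (toℕ x) s

ownerAt : ℕ → Fin 6 → Maybe (Fin 6)
ownerAt o x = if d <ᵇ 6 then just (d mod 6) else nothing
  where
  d = digit 10 (toℕ x) o

valid? : ∀ {h} (H : Digraph h) slot own dom pat → Dec (Valid H slot own dom pat)
valid? H slot own dom pat =
  (Finₚ.all? λ u → Finₚ.all? λ v → ¬? (own u ≟ᵒ own v) →-dec (H u v ≟ᵇ before (slot u) (slot v))) ×-dec
  (Finₚ.all? λ c → Finₚ.all? λ u → (own u ≟ᵒ just c) →-dec (¬? (u Finₚ.≟ c) →-dec
    ((isLin (slot c) ≟ᵇ true) ×-dec (isMid (slot u) ≟ᵇ true) ×-dec
    (Finₚ.all? λ v → (own v ≟ᵒ just c) →-dec (¬? (v Finₚ.≟ c) →-dec (H u v ≟ᵇ before (slot u) (slot v))))))) ×-dec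
  (Finₚ.all? λ u → (own u ≟ᵒ nothing) →-dec ((dom (slot u) ≟ᵇ true) ×-dec
    (Finₚ.all? λ v → (own v ≟ᵒ nothing) →-dec ((H u v ≟ᵇ true) →-dec (pat (slot u) (slot v) ≟ᵇ true)))))
  where
  _≟ᵒ_ = Maybe.≡-dec Finₚ._≟_

-- The index `zero` is a dummy where no triangle occurs; only the second ordering of a pair must be
-- valid for every central interval.
ValidScheme : Digraph 6 → Scheme → Set
ValidScheme H (stars s o) = Valid H (slotAt zero s) (ownerAt o) (λ _ → false) (λ _ _ → false)
ValidScheme H (pair s o s′ o′) = Valid H (slotAt zero s) (ownerAt o) cleanDom cleanPat ×
  (∀ j → central j ≡ true → Valid H (slotAt j s′) (ownerAt o′) (triangleDom j) trianglePat)

validScheme? : ∀ H s → Dec (ValidScheme H s)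
validScheme? H (stars s o) = valid? H (slotAt zero s) (ownerAt o) (λ _ → false) (λ _ _ → false)
validScheme? H (pair s o s′ o′) = valid? H (slotAt zero s) (ownerAt o) cleanDom cleanPat ×-dec
  (Finₚ.all? λ j → (central j ≟ᵇ true) →-dec valid? H (slotAt j s′) (ownerAt o′) (triangleDom j) trianglePat)

schemes-valid : All (λ (c , s) → ValidScheme (decode 6 c) s) schemes
schemes-valid = toWitness {a? = all? (λ (c , s) → validScheme? (decode 6 c) s) schemes} _

plan : ∀ {H} s → ValidScheme H s → Plan H
plan (stars s o) valid = stars-only _ _ valid
plan (pair s o s′ o′) (valid , valid′) = pair-or-triangle _ _ _ _ valid valid′

code-D : ℕ
code-D = 27511

-- On six vertices the codes are that of `H-D` and those with a scheme, so membership itself yields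
-- a plan or the exceptional tournament.
codes : ℕ → List ℕ
codes 6 = code-D ∷ map proj₁ schemes
codes k = map proj₁ (table k)

-- The reduction only makes the map total; that it permutes the vertices follows from its preserving
-- arcs, by `F-injective`.
permAt : ∀ {k} → ℕ → Fin (suc k) → Fin (suc k)
permAt {k} p x = digit 10 (toℕ x) p mod suc k

value : ∀ {k} → Vec Bool k → ℕ
value [] = 0
value (b ∷ v) = ⟦ b ⟧ + 2 * value v

nth : List (ℕ × ℕ) → ℕ → ℕ × ℕ
nth [] _ = 0 , 0
nth (e ∷ es) zero = e
nth (e ∷ es) (suc i) = nth es i

ValidEntry : ∀ k → ℕ → Vec Bool k → ℕ × ℕ → Set
ValidEntry k c v (c′ , p) = c′ ∈ codes (suc k) ×
  (∀ x y → decode (suc k) c′ x y ≡ extend v (decode k c) (permAt p x) (permAt p y))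

allVec? : ∀ {k} {P : Vec Bool k → Set} → (∀ v → Dec (P v)) → Dec (∀ v → P v)
allVec? {zero} P? = map′ (λ { p [] → p }) (λ f → f []) (P? [])
allVec? {suc k} P? = map′ (λ { (p , q) (true ∷ v) → p v ; (p , q) (false ∷ v) → q v }) (λ f → f ∘ (true ∷_) , f ∘ (false ∷_))
  (allVec? (P? ∘ (true ∷_)) ×-dec allVec? (P? ∘ (false ∷_)))

ValidTable : ℕ → Set
ValidTable k = All (λ (c , es) → ∀ v → ValidEntry k c v (nth es (value v))) (table k)

validTable? : ∀ k → Dec (ValidTable k)
validTable? k = all? (λ (c , es) → allVec? λ v → let e = nth es (value v) in
  Any.any? (proj₁ e ≟_) (codes (suc k)) ×-dec
  (Finₚ.all? λ x → Finₚ.all? λ y → decode (suc k) (proj₁ e) x y ≟ᵇ extend v (decode k c) (permAt (proj₂ e) x) (permAt (proj₂ e) y)))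
  (table k)

table-valid : ∀ k → k < 6 → ValidTable k
table-valid 0 _ = toWitness {a? = validTable? 0} _
table-valid 1 _ = toWitness {a? = validTable? 1} _
table-valid 2 _ = toWitness {a? = validTable? 2} _
table-valid 3 _ = toWitness {a? = validTable? 3} _
table-valid 4 _ = toWitness {a? = validTable? 4} _
table-valid 5 _ = toWitness {a? = validTable? 5} _
table-valid (suc (suc (suc (suc (suc (suc _)))))) (s≤s (s≤s (s≤s (s≤s (s≤s (s≤s ()))))))

-- Relabelling, classification and conclusion

injective⇒surjective : ∀ {n} (f : Fin n → Fin n) → Injective _≡_ _≡_ f → ∀ y → ∃ λ x → f x ≡ y
injective⇒surjective {suc n} f inj y with Finₚ.any? (λ x → f x Finₚ.≟ y)
... | yes hit = hit
... | no miss = ⊥-elim (1+n≰n (injective⇒≤ {f = λ x → punchOut (avoids x)} λ {x} {x′} e → inj (punchOut-injective (avoids x) (avoids x′) e)))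
  where
  avoids : ∀ x → y ≢ f x
  avoids x e = miss (x , sym e)

module Labelling {n} {H H′ : Digraph n} (tour′ : IsTournament H′) (irrefl : ∀ x → H x x ≡ false)
  (F : Fin n → Fin n) (F-arcs : ∀ x y → H′ x y ≡ H (F x) (F y)) where

  -- Two identified vertices would have no arc in either direction, as `H` has no loops, whereas the
  -- tournament `H′` has exactly one.
  F-injective : Injective _≡_ _≡_ F
  F-injective {x} {y} e with x Finₚ.≟ y
  ... | yes x≡y = x≡y
  ... | no x≢y = ⊥-elim (true≢false (trans (sym (cong not (none y x (sym e)))) (trans (sym (IsTournament.total tour′ x y x≢y)) (none x y e))))
    where
    none : ∀ x y → F x ≡ F y → H′ x y ≡ false
    none x y e = trans (F-arcs x y) (trans (cong (H (F x)) (sym e)) (irrefl (F x)))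

  F⁻¹ : Fin n → Fin n
  F⁻¹ y = proj₁ (injective⇒surjective F F-injective y)

  F∘F⁻¹ : ∀ y → F (F⁻¹ y) ≡ y
  F∘F⁻¹ y = proj₂ (injective⇒surjective F F-injective y)

  F⁻¹-injective : Injective _≡_ _≡_ F⁻¹
  F⁻¹-injective {x} {y} e = trans (sym (F∘F⁻¹ x)) (trans (cong F e) (F∘F⁻¹ y))

  F⁻¹-arcs : ∀ x y → H x y ≡ H′ (F⁻¹ x) (F⁻¹ y)
  F⁻¹-arcs x y = trans (sym (cong₂ H (F∘F⁻¹ x) (F∘F⁻¹ y))) (sym (F-arcs (F⁻¹ x) (F⁻¹ y)))

  isomorphic : Isomorphic H H′
  isomorphic = mk⤖ (F⁻¹-injective , λ y → F y , λ { refl → F-injective (F∘F⁻¹ (F y)) }) , F⁻¹-arcs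

  embeds⇒contains : ∀ {m} {T : Digraph m} → IsTournament T → Embeds T H′ → Contains T H
  embeds⇒contains {T = T} tour (f , arcs) = f ∘ F⁻¹ , F⁻¹-injective ∘ f-injective , λ x y → trans (F⁻¹-arcs x y) (f-arcs (F⁻¹ x) (F⁻¹ y))
    where
    module H′ = Tournament tour′
    open Tournament tour using (flip-true; arc⇒≢) renaming (irrefl to T-irrefl)
    f-arcs : ∀ x y → H′ x y ≡ T (f x) (f y)
    f-arcs x y with x Finₚ.≟ y | H′ x y in e
    ... | yes refl | _ = trans (sym e) (trans (H′.irrefl x) (sym (T-irrefl (f x))))
    ... | no _ | true = sym (arcs e)
    ... | no x≢y | false = sym (flip-true (arcs (H′.flip-false x≢y e)))
    f-injective : Injective _≡_ _≡_ f
    f-injective {x} {y} e with x Finₚ.≟ y | H′ x y in h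
    ... | yes x≡y | _ = x≡y
    ... | no _ | true = ⊥-elim (arc⇒≢ (arcs h) e)
    ... | no x≢y | false = ⊥-elim (arc⇒≢ (arcs (H′.flip-false x≢y h)) (sym e))

codes-table : ∀ k → k < 6 → codes k ≡ map proj₁ (table k)
codes-table 0 _ = refl
codes-table 1 _ = refl
codes-table 2 _ = refl
codes-table 3 _ = refl
codes-table 4 _ = refl
codes-table 5 _ = refl
codes-table (suc (suc (suc (suc (suc (suc _)))))) (s≤s (s≤s (s≤s (s≤s (s≤s (s≤s ()))))))

-- Vertex `zero` is deleted and the rest classified; its arcs, read along the labelling `F`, form
-- the vector `v` that selects the table entry.
classify : ∀ k → k ≤ 6 → (H : Digraph k) → IsTournament H →
  ∃ λ c → c ∈ codes k × Σ (Fin k → Fin k) λ F → ∀ x y → decode k c x y ≡ H (F x) (F y)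
classify zero _ H _ = 0 , here refl , (λ ()) , λ ()
classify (suc k) k<6 H tour with classify k (<⇒≤ k<6) (λ x y → H (suc x) (suc y)) tail-tour
  where
  tail-tour : IsTournament (λ x y → H (suc x) (suc y))
  tail-tour = record { irrefl = IsTournament.irrefl tour ∘ suc ; total = λ x y x≢y → IsTournament.total tour (suc x) (suc y) (x≢y ∘ Finₚ.suc-injective) }
... | c , c∈ , F , F-arcs with ∈-map⁻ proj₁ (subst (c ∈_) (codes-table k k<6) c∈)
...   | (_ , es) , row , refl with All.lookup (table-valid k k<6) row v
  where
  v : Vec Bool k
  v = tabulate (λ x → H zero (suc (F x)))
...     | c′∈ , arcs = _ , c′∈ , F′ ∘ permAt _ , λ x y → trans (arcs x y) (extended (permAt _ x) (permAt _ y))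
  where
  F′ : Fin (suc k) → Fin (suc k)
  F′ zero = zero
  F′ (suc x) = suc (F x)
  extended : ∀ x y → extend (tabulate (λ x → H zero (suc (F x)))) (decode k c) x y ≡ H (F′ x) (F′ y)
  extended zero zero = sym (IsTournament.irrefl tour zero)
  extended zero (suc y) = lookup∘tabulate _ y
  extended (suc x) zero = trans (cong not (lookup∘tabulate _ x)) (sym (IsTournament.total tour (suc (F x)) zero λ ()))
  extended (suc x) (suc y) = F-arcs x y

decode-D : ∀ x y → H-D x y ≡ decode 6 code-D x y
decode-D = toWitness {a? = Finₚ.all? λ x → Finₚ.all? λ y → H-D x y ≟ᵇ decode 6 code-D x y} _

chain-lookup : ∀ {n} {T : Digraph n} {l} → Chain T l → ∀ {i j} → i Fin.< j → T (lookup l i) (lookup l j) ≡ true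
chain-lookup (a ∷ _) {zero} {suc j} _ = All.lookup a (∈-lookup j)
chain-lookup (_ ∷ ch) {suc i} {suc j} (s≤s lt) = chain-lookup ch lt

-- Every arc raises the position in the chain, so the closing arc of a cycle would have to return to
-- an earlier position.
chain⇒transitive : ∀ {n} {T : Digraph n} → IsTournament T → ∀ l → Chain T l → HasTransitiveSub T (length l)
chain⇒transitive {T = T} tour l ch = lookup l , injective , acyclic
  where
  open Tournament tour
  forward : ∀ i j → T (lookup l i) (lookup l j) ≡ true → i Fin.< j
  forward i j e with Finₚ.<-cmp i j
  ... | tri< lt _ _ = lt
  ... | tri≈ _ refl _ = ⊥-elim (arc⇒≢ e refl)
  ... | tri> _ _ gt = ⊥-elim (true≢false (trans (sym e) (flip-true (chain-lookup ch gt))))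
  injective : Injective _≡_ _≡_ (lookup l)
  injective {i} {j} e with Finₚ.<-cmp i j
  ... | tri< lt _ _ = ⊥-elim (arc⇒≢ (chain-lookup ch lt) e)
  ... | tri≈ _ i≡j _ = i≡j
  ... | tri> _ _ gt = ⊥-elim (arc⇒≢ (chain-lookup ch gt) (sym e))
  ascending : ∀ {k} len (g : Fin (suc len) → Fin k) → (∀ i → g (inject₁ i) Fin.< g (suc i)) → g zero Fin.≤ g (fromℕ len)
  ascending zero g up = ≤-refl
  ascending (suc len) g up = ≤-trans (<⇒≤ (up zero)) (ascending len (g ∘ suc) (up ∘ suc))
  acyclic : IsTransitive (induced T (lookup l))
  acyclic cycle = n≮n _ (<-≤-trans (forward _ _ close) (ascending len cyc (λ i → forward _ _ (step i))))
    where open DirectedCycle cycle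

-- There are seven pieces, the special one and six possible stars; 14 is twice that, and 48 is twice
-- the number of intervals.
plan⇒EH : ∀ {H} → IsTournament H → Plan H → ∃ λ q → 0 < q × EH H q
plan⇒EH {H} tour p = from (forced tour p {7} {14} {48} ≤-refl ≤-refl refl)
  where
  from : (∃₂ λ C m → 0 < m × Forced H 48 C m) → ∃ λ q → 0 < q × EH H q
  from (_ , _ , 0<m , unavoidable) = Forced⇒EH unavoidable 0<m

theorem18 : (H : Digraph 6) → IsTournament H → ¬ Isomorphic H H-D →
    Σ ℕ λ p → Σ ℕ λ q → p > 0 × q > 0 ×
    ((n : ℕ) (T : Digraph n) → IsTournament T → ¬ Contains T H →
    Σ ℕ λ k → HasTransitiveSub T k × n ^ p ≤ k ^ q)
theorem18 H tour ≇D = from (classify 6 ≤-refl H tour)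
  where
  Goal : Set
  Goal = Σ ℕ λ p → Σ ℕ λ q → p > 0 × q > 0 ×
    ((n : ℕ) (T : Digraph n) → IsTournament T → ¬ Contains T H →
    Σ ℕ λ k → HasTransitiveSub T k × n ^ p ≤ k ^ q)
  D-tour : IsTournament H-D
  D-tour = record
    { irrefl = λ x → trans (decode-D x x) (IsTournament.irrefl (decode-isTournament 6 code-D) x)
    ; total = λ x y x≢y → trans (decode-D x y) (trans (IsTournament.total (decode-isTournament 6 code-D) x y x≢y) (cong not (sym (decode-D y x)))) }
  conclude : ∀ {H′ F} → IsTournament H′ → (∀ x y → H′ x y ≡ H (F x) (F y)) → (∃ λ q → 0 < q × EH H′ q) → Goal
  -- The exponent obtained is `1 / q`, hence `p = 1`; a copy of the representative `H′` is
  -- relabelled to a copy of `H`.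
  conclude {H′} {F} tour′ F-arcs (q , 0<q , eh) = 1 , q , s≤s z≤n , 0<q , λ n T T-tour free →
    finish (eh n T T-tour (free ∘ Labelling.embeds⇒contains tour′ (IsTournament.irrefl tour) F F-arcs T-tour)) T-tour
    where
    finish : ∀ {n} {T : Digraph n} → (Σ (List (Fin n)) λ l → Chain T l × n ≤ length l ^ q) → IsTournament T →
      Σ ℕ λ k → HasTransitiveSub T k × n ^ 1 ≤ k ^ q
    finish {n} (l , ch , n≤) T-tour = length l , chain⇒transitive T-tour l ch , subst (_≤ length l ^ q) (sym (*-identityʳ n)) n≤
  from : (∃ λ c → c ∈ codes 6 × Σ (Fin 6 → Fin 6) λ F → ∀ x y → decode 6 c x y ≡ H (F x) (F y)) → Goal
  from (_ , here refl , F , F-arcs) =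
    ⊥-elim (≇D (Labelling.isomorphic D-tour (IsTournament.irrefl tour) F (λ x y → trans (decode-D x y) (F-arcs x y))))
  from (c , there c∈ , F , F-arcs) with ∈-map⁻ proj₁ c∈
  ... | (_ , s) , s∈ , refl =
    conclude (decode-isTournament 6 c) F-arcs (plan⇒EH (decode-isTournament 6 c) (plan s (All.lookup schemes-valid s∈)))
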